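{- The following optimization problem can be solved in polynomial time: given a finite set $X$ of strings over an alphabet, find a schedule $\mathcal S$ of $X$ minimizing $\sum_{B\in\mathcal S}|\mathcal C(B)|$, where $|\mathcal C(B)|$ is the number of phrases in the run length encoding of the concatenation of the strings of batch $B$ in their batch order.
   Context: A batch of $X$ is an ordered subset of $X$ (a sequence of distinct elements), identified with the concatenation of its strings in order; a schedule of $X$ is a partition of $X$ into batches. Run length encoding parses a string into maximal runs of a single repeated character, each run encoded as a phrase $(\sigma,n)$ (character $\sigma$ repeated $n$ times); the number of phrases is the number of maximal runs. -}

module Defs where

open import Data.Bool.Base using (Bool; true; false)
open import Data.Fin.Base using (Fin; zero)
open import Data.List.Base using (List; []; _∷_; length; map; concat; foldr)
open import Data.List.Membership.Propositional using (_∈_)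
open import Data.List.Relation.Binary.Disjoint.Propositional using (Disjoint)
open import Data.List.Relation.Binary.Subset.Propositional using (_⊆_)
open import Data.List.Relation.Unary.All using (All)
open import Data.List.Relation.Unary.AllPairs using (AllPairs)
open import Data.List.Relation.Unary.Any using (Any)
open import Data.List.Relation.Unary.Unique.Propositional using (Unique)
open import Data.Nat.Base using (ℕ; suc; _+_; _*_; _≤_)
open import Data.Nat.ListAction using (sum)
open import Data.Product.Base using (Σ-syntax; ∃-syntax; _×_; _,_)
open import Data.Vec.Base using (Vec; lookup; replicate; _[_]≔_)
  renaming (_∷_ to _∷ᵛ_)
open import Function.Definitions using (Injective)
open import Relation.Binary.Definitions using (DecidableEquality)
open import Relation.Binary.PropositionalEquality using (_≡_; _≢_)
open import Relation.Nullary.Decidable using (yes; no)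

------------------------------------------------------------------------
-- Model of computation: the WHILE language over binary trees of
-- N. D. Jones, "Computability and Complexity from a Programming
-- Perspective" (1997), with its unit-cost time measure, for which the
-- polynomial-time problems are those of Turing machines.  Variables
-- hold pointers to shared cells, so copying a variable costs one unit;
-- there is no primitive comparison of trees.

infixr 5 _∙_

data Tree : Set where
  nil : Tree
  _∙_ : Tree → Tree → Tree

size : Tree → ℕ
size nil     = 1
size (l ∙ r) = 1 + size l + size r

data Expr (k : ℕ) : Set where
  var  : Fin k → Expr k
  nil  : Expr k
  cons : Expr k → Expr k → Expr k
  hd   : Expr k → Expr k
  tl   : Expr k → Expr k

infix  6 _:=_
infixr 5 _⨾_

data Command (k : ℕ) : Set where
  _:=_          : Fin k → Expr k → Command k
  _⨾_           : Command k → Command k → Command k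
  if_then_else_ : Expr k → Command k → Command k → Command k
  while_loop_   : Expr k → Command k → Command k

Store : ℕ → Set
Store k = Vec Tree k

head : Tree → Tree
head nil     = nil
head (l ∙ r) = l

tail : Tree → Tree
tail nil     = nil
tail (l ∙ r) = r

⟦_⟧ : ∀ {k} → Expr k → Store k → Tree
⟦ var x ⟧    σ = lookup σ x
⟦ nil ⟧      σ = nil
⟦ cons e f ⟧ σ = ⟦ e ⟧ σ ∙ ⟦ f ⟧ σ
⟦ hd e ⟧     σ = head (⟦ e ⟧ σ)
⟦ tl e ⟧     σ = tail (⟦ e ⟧ σ)

exprTime : ∀ {k} → Expr k → ℕ
exprTime (var x)    = 1
exprTime nil        = 1
exprTime (cons e f) = 1 + exprTime e + exprTime f
exprTime (hd e)     = 1 + exprTime e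
exprTime (tl e)     = 1 + exprTime e

infix 4 _⊢_⇓_[_]

-- c ⊢ σ ⇓ τ [ t ]: started in store σ, the command c terminates in
-- store τ after t units of time.  In tests nil is false, and every
-- other tree is true.
data _⊢_⇓_[_] {k : ℕ} : Command k → Store k → Store k → ℕ → Set where
  assign : ∀ {σ x e} →
    x := e ⊢ σ ⇓ σ [ x ]≔ ⟦ e ⟧ σ [ 1 + exprTime e ]
  seq : ∀ {σ τ υ c d s t} →
    c ⊢ σ ⇓ τ [ s ] → d ⊢ τ ⇓ υ [ t ] →
    c ⨾ d ⊢ σ ⇓ υ [ s + t ]
  if-true : ∀ {σ τ e c d t} →
    ⟦ e ⟧ σ ≢ nil → c ⊢ σ ⇓ τ [ t ] →
    if e then c else d ⊢ σ ⇓ τ [ 1 + exprTime e + t ]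
  if-false : ∀ {σ τ e c d t} →
    ⟦ e ⟧ σ ≡ nil → d ⊢ σ ⇓ τ [ t ] →
    if e then c else d ⊢ σ ⇓ τ [ 1 + exprTime e + t ]
  while-true : ∀ {σ τ υ e c s t} →
    ⟦ e ⟧ σ ≢ nil → c ⊢ σ ⇓ τ [ s ] → while e loop c ⊢ τ ⇓ υ [ t ] →
    while e loop c ⊢ σ ⇓ υ [ 1 + exprTime e + s + t ]
  while-false : ∀ {σ e c} →
    ⟦ e ⟧ σ ≡ nil →
    while e loop c ⊢ σ ⇓ σ [ 1 + exprTime e ]

-- Variable zero carries the input and, on termination, the output;
-- the other variables are initially nil.
record Program : Set where
  field
    locals : ℕ
    body   : Command (suc locals)

Computes_from_to_after_ : Program → Tree → Tree → ℕ → Set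
Computes P from x to y after t =
  Σ[ τ ∈ Store (suc locals) ]
    (body ⊢ x ∷ᵛ replicate locals nil ⇓ τ [ t ]) × lookup τ zero ≡ y
  where open Program P

-- Coefficients are listed from the constant term upwards.
Polynomial : Set
Polynomial = List ℕ

eval : Polynomial → ℕ → ℕ
eval p n = foldr (λ a v → a + n * v) 0 p

------------------------------------------------------------------------
-- Minimization problems

record MinimizationProblem : Set₂ where
  field
    Instance       : Set₁
    Candidate      : Instance → Set
    Feasible       : (I : Instance) → Candidate I → Set
    cost           : (I : Instance) → Candidate I → ℕ
    encodeInstance : Instance → Tree
    encodeSolution : (I : Instance) → Candidate I → Tree

  Optimal : (I : Instance) → Candidate I → Set
  Optimal I S = Feasible I S × (∀ S′ → Feasible I S′ → cost I S ≤ cost I S′)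

SolvableInPolynomialTime : MinimizationProblem → Set₁
SolvableInPolynomialTime Π =
  Σ[ P ∈ Program ] Σ[ p ∈ Polynomial ] ∀ (I : Instance) →
    Σ[ S ∈ Candidate I ] Optimal I S ×
      (∃[ t ] (Computes P from encodeInstance I to encodeSolution I S after t)
            × t ≤ eval p (size (encodeInstance I)))
  where open MinimizationProblem Π

------------------------------------------------------------------------
-- Alphabets, run length encoding, schedules

-- An alphabet comes with a binary code for its characters, which is how
-- they are presented to a program.
record Alphabet : Set₁ where
  infix 4 _≟_
  field
    Char           : Set
    _≟_            : DecidableEquality Char
    code           : Char → List Bool
    code-injective : Injective _≡_ _≡_ code

  String : Set
  String = List Char

  -- The phrase (c , n) stands for n copies of c.
  Phrase : Set
  Phrase = Char × ℕ

  prepend : Char → List Phrase → List Phrase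
  prepend c []             = (c , 1) ∷ []
  prepend c ((d , n) ∷ ps) with c ≟ d
  ... | yes _ = (d , suc n) ∷ ps
  ... | no  _ = (c , 1) ∷ (d , n) ∷ ps

  runLengthEncoding : String → List Phrase
  runLengthEncoding = foldr prepend []

  Batch : Set
  Batch = List String

  phrases : Batch → ℕ
  phrases B = length (runLengthEncoding (concat B))

  totalPhrases : List Batch → ℕ
  totalPhrases S = sum (map phrases S)

  record IsBatch (X : List String) (B : Batch) : Set where
    field
      distinct : Unique B
      subset   : B ⊆ X

  record IsSchedule (X : List String) (S : List Batch) : Set where
    field
      batches  : All (IsBatch X) S
      nonempty : All (_≢ []) S
      disjoint : AllPairs Disjoint S
      covering : ∀ {x} → x ∈ X → Any (x ∈_) S

encodeList : ∀ {A : Set} → (A → Tree) → List A → Tree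
encodeList f []       = nil
encodeList f (x ∷ xs) = f x ∙ encodeList f xs

encodeBit : Bool → Tree
encodeBit false = nil
encodeBit true  = nil ∙ nil

encodeString : (A : Alphabet) → Alphabet.String A → Tree
encodeString A = encodeList (λ c → encodeList encodeBit (Alphabet.code A c))

-- The alphabet belongs to the instance, so that a single program has to
-- deal with all alphabets.
record StringSet : Set₁ where
  field
    alphabet : Alphabet
  open Alphabet alphabet public
  field
    strings : List String
    unique  : Unique strings

minimumRLESchedule : MinimizationProblem
minimumRLESchedule = record
  { Instance       = StringSet
  ; Candidate      = λ I → List (StringSet.Batch I)
  ; Feasible       = λ I → StringSet.IsSchedule I (StringSet.strings I)
  ; cost           = StringSet.totalPhrases
  ; encodeInstance = λ I →
      encodeList (encodeString (StringSet.alphabet I)) (StringSet.strings I)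
  ; encodeSolution = λ I →
      encodeList (encodeList (encodeString (StringSet.alphabet I)))
  }

{-# OPTIONS --safe #-}

-- Two consecutive strings of a batch share a phrase exactly if the last
-- character of the one is the first character of the next (the empty string
-- aside), so one batch suffices, and the strings have to be ordered with as
-- many such joins as possible.  If a nonempty string is taken as an edge from
-- its first to its last character, an order decomposes a directed multigraph
-- into trails, whose number is to be minimized.
--
-- Local search over interchanges of two blocks, ps as bs cs zs to
-- ps cs bs as zs, finds a global minimum.  If no interchange helps, then no
-- trail ends where another one starts, and a closed trail has no vertex in
-- common with another trail, or else it could be rotated and spliced in.  Such a
-- decomposition is minimal: at the vertices where open trails start, the
-- difference of out-degree and in-degree forces as many trails in every
-- decomposition, and the closed trails are entire components, each of which
-- needs a further trail.
--
-- Every round of the search tries polynomially many interchanges, and every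
-- round that changes the order saves a phrase.
module Submission where

open import Defs

import Algebra.Properties.CommutativeSemigroup
import Algebra.Solver.Monoid
open import Data.Bool.Base using (Bool; true; false)
open import Data.Fin.Base using (zero)
open import Data.List.Base
  using (List; []; _∷_; _++_; _ʳ++_; concat; concatMap; drop; filter; foldl; foldr; length; map;
         mapMaybe; reverse)
import Data.List.Membership.DecPropositional as DecMembership
open import Data.List.Membership.Propositional using (_∈_; find; lose)
open import Data.List.Membership.Propositional.Properties
  using (∈-++⁺ˡ; ∈-++⁺ʳ; ∈-++⁻; ∈-∃++; ∈-concat⁺; ∈-concat⁻′; ∈-concatMap⁺; ∈-concatMap⁻;
         ∈-filter⁻; ∈-map⁻)
open import Data.List.Membership.Propositional.Properties.WithK using (unique∧set⇒bag)
open import Data.List.Properties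
  using (++-assoc; ++-monoid; ++-ʳ++; concat-++; concatMap-++; length-++; length-map;
         length-reverse; map-++; mapMaybe-++; reverse-foldl; ʳ++-defn; ʳ++-ʳ++; ∷-injective;
         ∷-injectiveʳ)
open import Data.List.Relation.Binary.BagAndSetEquality using (∼bag⇒↭)
open import Data.List.Relation.Binary.Disjoint.Propositional using (Disjoint)
open import Data.List.Relation.Binary.Permutation.Propositional
  using (_↭_; refl; prep; swap; trans; ↭-refl; ↭-reflexive; ↭-sym; ↭-trans; ↭⇒↭ₛ;
         module PermutationReasoning)
open import Data.List.Relation.Binary.Permutation.Propositional.Properties
  using (++⁺ˡ; map⁺; mapMaybe-↭; shifts; ¬x∷xs↭[]; ∈-resp-↭)
import Data.List.Relation.Binary.Permutation.Setoid.Properties as PermutationSetoid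
open import Data.List.Relation.Binary.Subset.Propositional using (_⊆_)
open import Data.List.Relation.Unary.All as All using (All; []; _∷_)
import Data.List.Relation.Unary.All.Properties as All
open import Data.List.Relation.Unary.AllPairs using (AllPairs; []; _∷_)
open import Data.List.Relation.Unary.Any using (Any; here; there; any?)
open import Data.List.Relation.Unary.Unique.Propositional using (Unique)
import Data.List.Relation.Unary.Unique.Propositional.Properties as Unique
open import Data.Maybe.Base using (Maybe; just; nothing)
open import Data.Nat.Base using (ℕ; suc; _+_; _*_; _∸_; _≤_; _<_; z≤n; s≤s)
open import Data.Nat.ListAction using (sum)
open import Data.Nat.ListAction.Properties using (sum-++; sum-↭)
open import Data.Nat.Properties hiding (_≟_)
open import Data.Nat.Solver using (module +-*-Solver)
open import Data.Product.Base using (Σ-syntax; ∃-syntax; _×_; _,_; proj₁; proj₂)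
open import Data.Sum.Base using (_⊎_; inj₁; inj₂)
open import Data.Unit.Base using (⊤; tt)
open import Data.Vec.Base using () renaming ([] to []ᵛ; _∷_ to _∷ᵛ_)
open import Function.Base using (_∘_)
open import Function.Bundles using (mk⇔)
open import Relation.Binary.Definitions using (DecidableEquality; Symmetric)
open import Relation.Binary.PropositionalEquality.Core
  using (_≡_; _≢_; refl; sym; cong; cong₂; subst) renaming (trans to ≡-trans)
open import Relation.Binary.PropositionalEquality.Properties using (setoid; module ≡-Reasoning)
open import Relation.Nullary.Decidable using (Dec; yes; no; _×-dec_; ¬?)
open import Relation.Nullary.Negation using (¬_; contradiction)

open +-*-Solver using (solve; con; _:+_; _:*_) renaming (_:=_ to _:≡_)

-- The machine model has no procedures, no numbers and no test for equal trees. The search is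
-- therefore made of left folds, each of which becomes a loop with as many rounds as an encoded list
-- has entries. Numbers occur only as lengths of lists, and characters are compared through their
-- codes, bit by bit. The obstacle is the size of intermediate values: a bound that is polynomial in
-- the current state, iterated over a loop, is no longer polynomial. Every fold must therefore
-- enlarge its state by at most a polynomial in the context and the current item. The rounds of the
-- search comply because they only permute the strings. For the lower bound on the number of trails,
-- vertices receive weights and colours. The sum of the weights over all sources of edges, and
-- likewise over all targets, depends on the multiset of edges and not on its order, while along a
-- single trail the two sums differ by the weights of its ends. This makes two decompositions of the
-- same edges comparable.

private variable
  A B : Set
  J K : Set₁
  e f g : J → Tree

-- Polynomials

infixl 6 _⊕_
infixl 7 _⊗_
infixr 8 _⊚_

-- Bounds of composed commands are huge terms; outside this block they are handled only through the
-- `eval` equations.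
opaque
  _⊕_ : Polynomial → Polynomial → Polynomial
  []      ⊕ q       = q
  p       ⊕ []      = p
  (a ∷ p) ⊕ (b ∷ q) = (a + b) ∷ (p ⊕ q)

  _⊗_ : Polynomial → Polynomial → Polynomial
  []      ⊗ q = []
  (a ∷ p) ⊗ q = map (a *_) q ⊕ (0 ∷ p ⊗ q)

  _⊚_ : Polynomial → Polynomial → Polynomial
  []      ⊚ q = []
  (a ∷ p) ⊚ q = (a ∷ []) ⊕ q ⊗ (p ⊚ q)

  const : ℕ → Polynomial
  const a = a ∷ []

  X : Polynomial
  X = 0 ∷ 1 ∷ []

  eval-⊕ : ∀ p q n → eval (p ⊕ q) n ≡ eval p n + eval q n
  eval-⊕ []      q       n = refl
  eval-⊕ (a ∷ p) []      n = sym (+-identityʳ _)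
  eval-⊕ (a ∷ p) (b ∷ q) n rewrite eval-⊕ p q n =
    solve 5 (λ a b n x y → a :+ b :+ n :* (x :+ y) :≡ a :+ n :* x :+ (b :+ n :* y))
      refl a b n (eval p n) (eval q n)

  eval-scale : ∀ a q n → eval (map (a *_) q) n ≡ a * eval q n
  eval-scale a []      n = sym (*-zeroʳ a)
  eval-scale a (b ∷ q) n rewrite eval-scale a q n =
    solve 4 (λ a b n y → a :* b :+ n :* (a :* y) :≡ a :* (b :+ n :* y)) refl a b n (eval q n)

  eval-⊗ : ∀ p q n → eval (p ⊗ q) n ≡ eval p n * eval q n
  eval-⊗ []      q n = refl
  eval-⊗ (a ∷ p) q n
    rewrite eval-⊕ (map (a *_) q) (0 ∷ p ⊗ q) n | eval-scale a q n | eval-⊗ p q n =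
    solve 4 (λ a n x y → a :* y :+ n :* (x :* y) :≡ (a :+ n :* x) :* y)
      refl a n (eval p n) (eval q n)

  eval-⊚ : ∀ p q n → eval (p ⊚ q) n ≡ eval p (eval q n)
  eval-⊚ []      q n = refl
  eval-⊚ (a ∷ p) q n
    rewrite eval-⊕ (const a) (q ⊗ (p ⊚ q)) n | eval-⊗ q (p ⊚ q) n | eval-⊚ p q n
          | *-zeroʳ n | +-identityʳ a = refl

  eval-const : ∀ a n → eval (const a) n ≡ a
  eval-const a n rewrite *-zeroʳ n = +-identityʳ a

  eval-X : ∀ n → eval X n ≡ n
  eval-X n rewrite *-zeroʳ n = *-identityʳ n

eval-mono : ∀ p {m n} → m ≤ n → eval p m ≤ eval p n
eval-mono []      m≤n = z≤n
eval-mono (a ∷ p) m≤n = +-monoʳ-≤ a (*-mono-≤ m≤n (eval-mono p m≤n))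

-- Polynomial-time computable functions on trees

-- A command of one variable, used as a stack: it replaces the topmost
-- entry e j by f j, whatever lies below.  As sharing makes trees grow
-- exponentially faster than time, the size of f j is bounded separately.
infix 4 _⟶_
record _⟶_ {J : Set₁} (e f : J → Tree) : Set₁ where
  field
    command : Command 1
    time    : Polynomial
    growth  : Polynomial
    run     : ∀ j ρ → ∃[ t ]
      (command ⊢ (e j ∙ ρ) ∷ᵛ []ᵛ ⇓ (f j ∙ ρ) ∷ᵛ []ᵛ [ t ]) × t ≤ eval time (size (e j))
    bound   : ∀ j → size (f j) ≤ eval growth (size (e j))

open _⟶_ public

stack : Expr 1
stack = var zero

top rest : Expr 1
top  = hd stack
rest = tl stack

size≥1 : ∀ x → 1 ≤ size x
size≥1 nil     = s≤s z≤n
size≥1 (l ∙ r) = s≤s z≤n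

basic : (E : Expr 1) (q : Polynomial) →
  (∀ j ρ → ⟦ E ⟧ ((e j ∙ ρ) ∷ᵛ []ᵛ) ≡ f j) →
  (∀ j → size (f j) ≤ eval q (size (e j))) → e ⟶ f
basic {e = e} {f = f} E q computes small = record
  { command = zero := cons E rest
  ; time    = const (1 + exprTime (cons E rest))
  ; growth  = q
  ; run     = λ j ρ → _
      , subst (λ v → (zero := cons E rest) ⊢ (e j ∙ ρ) ∷ᵛ []ᵛ ⇓ (v ∙ ρ) ∷ᵛ []ᵛ [ _ ])
          (computes j ρ) assign
      , ≤-reflexive (sym (eval-const _ (size (e j))))
  ; bound   = small
  }

input : e ⟶ e
input {e = e} = basic top X (λ _ _ → refl) λ j → ≤-reflexive (sym (eval-X (size (e j))))

nothing⟶ : e ⟶ λ _ → nil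
nothing⟶ {e = e} =
  basic nil (const 1) (λ _ _ → refl) λ j → ≤-reflexive (sym (eval-const 1 (size (e j))))

head-≤ : ∀ x → size (head x) ≤ size x
head-≤ nil     = ≤-refl
head-≤ (l ∙ r) = ≤-trans (m≤m+n _ _) (n≤1+n _)

tail-≤ : ∀ x → size (tail x) ≤ size x
tail-≤ nil     = ≤-refl
tail-≤ (l ∙ r) = ≤-trans (m≤n+m _ _) (n≤1+n _)

infixl 5 _⟫_
-- The second command runs on `f j`, whose size is controlled by `growth c` alone: time bounds
-- without growth bounds would not compose.
_⟫_ : e ⟶ f → f ⟶ g → e ⟶ g
_⟫_ {e = e} {f = f} {g = g} c d = record
  { command = command c ⨾ command d
  ; time    = time c ⊕ time d ⊚ growth c
  ; growth  = growth d ⊚ growth c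
  ; run     = λ j ρ →
      let s , c⇓ , s≤ = run c j ρ
          t , d⇓ , t≤ = run d j ρ
      in s + t , seq c⇓ d⇓ , (begin
        s + t
          ≤⟨ +-mono-≤ s≤ (≤-trans t≤ (eval-mono (time d) (bound c j))) ⟩
        eval (time c) (size (e j)) + eval (time d) (eval (growth c) (size (e j)))
          ≡⟨ cong (eval (time c) (size (e j)) +_) (eval-⊚ (time d) (growth c) (size (e j))) ⟨
        eval (time c) (size (e j)) + eval (time d ⊚ growth c) (size (e j))
          ≡⟨ eval-⊕ (time c) (time d ⊚ growth c) (size (e j)) ⟨
        eval (time c ⊕ time d ⊚ growth c) (size (e j)) ∎)
  ; bound   = λ j → begin
      size (g j)                                ≤⟨ bound d j ⟩
      eval (growth d) (size (f j))              ≤⟨ eval-mono (growth d) (bound c j) ⟩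
      eval (growth d) (eval (growth c) (size (e j))) ≡⟨ eval-⊚ (growth d) (growth c) (size (e j)) ⟨
      eval (growth d ⊚ growth c) (size (e j))   ∎
  }
  where open ≤-Reasoning

hd⟶ : e ⟶ f → e ⟶ head ∘ f
hd⟶ {f = f} c = c ⟫ basic (hd top) X (λ _ _ → refl)
  λ j → ≤-trans (head-≤ (f j)) (≤-reflexive (sym (eval-X _)))

tl⟶ : e ⟶ f → e ⟶ tail ∘ f
tl⟶ {f = f} c = c ⟫ basic (tl top) X (λ _ _ → refl)
  λ j → ≤-trans (tail-≤ (f j)) (≤-reflexive (sym (eval-X _)))

-- Correctness and bounds hold for each index separately. The steps of folds, whose index also
-- contains the item and the state, reuse commands for smaller contexts in this way.
reindex : (r : K → J) → e ⟶ f → e ∘ r ⟶ f ∘ r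
reindex r c = record
  { command = command c
  ; time    = time c
  ; growth  = growth c
  ; run     = run c ∘ r
  ; bound   = bound c ∘ r
  }

infixl 4 _≗⟶_
_≗⟶_ : e ⟶ f → (∀ j → f j ≡ g j) → e ⟶ g
_≗⟶_ {e = e} c f≗g = record
  { command = command c
  ; time    = time c
  ; growth  = growth c
  ; run     = λ j ρ → let t , c⇓ , t≤ = run c j ρ in
      t , subst (λ v → command c ⊢ (e j ∙ ρ) ∷ᵛ []ᵛ ⇓ (v ∙ ρ) ∷ᵛ []ᵛ [ t ]) (f≗g j) c⇓ , t≤
  ; bound   = λ j → subst (λ v → size v ≤ eval (growth c) (size (e j))) (f≗g j) (bound c j)
  }

duplicate swapped paired : Command 1
duplicate = zero := cons top stack
swapped   = zero := cons (hd rest) (cons top (tl rest))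
paired    = zero := cons (cons (hd rest) top) (tl rest)

infixr 5 _∙⟶_
-- A command consumes its argument, so a copy of `e j` waits below the top while `c` runs. This is
-- why `run` allows an arbitrary rest `ρ` of the stack.
_∙⟶_ : e ⟶ f → e ⟶ g → e ⟶ λ j → f j ∙ g j
_∙⟶_ {e = e} {f = f} {g = g} c d = record
  { command = duplicate ⨾ command c ⨾ swapped ⨾ command d ⨾ paired
  ; time    = const overhead ⊕ time c ⊕ time d
  ; growth  = const 1 ⊕ growth c ⊕ growth d
  ; run     = λ j ρ →
      let s , c⇓ , s≤ = run c j (e j ∙ ρ)
          t , d⇓ , t≤ = run d j (f j ∙ ρ)
          n = size (e j)
      in _ , seq assign (seq c⇓ (seq assign (seq d⇓ assign))) , (begin
        1 + exprTime (cons top stack) + (s + (1 + exprTime swap′ + (t + (1 + exprTime pair′))))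
          ≡⟨ solve 2 (λ s t → con 5 :+ (s :+ (con 11 :+ (t :+ con 11)))
                              :≡ con 27 :+ s :+ t) refl s t ⟩
        overhead + s + t
          ≤⟨ +-mono-≤ (+-monoʳ-≤ overhead s≤) t≤ ⟩
        overhead + eval (time c) n + eval (time d) n
          ≡⟨ evaluate overhead (time c) (time d) n ⟨
        eval (const overhead ⊕ time c ⊕ time d) n ∎)
  ; bound   = λ j → let n = size (e j) in begin
      1 + size (f j) + size (g j)
        ≤⟨ +-mono-≤ (+-monoʳ-≤ 1 (bound c j)) (bound d j) ⟩
      1 + eval (growth c) n + eval (growth d) n
        ≡⟨ evaluate 1 (growth c) (growth d) n ⟨
      eval (const 1 ⊕ growth c ⊕ growth d) n ∎
  }
  where
  open ≤-Reasoning
  -- 5 for `duplicate`, and 11 each for `swapped` and `paired`.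
  overhead = 27
  swap′ = cons (hd rest) (cons top (tl rest))
  pair′ = cons (cons (hd rest) top) (tl rest)
  evaluate : ∀ a p q n → eval (const a ⊕ p ⊕ q) n ≡ a + eval p n + eval q n
  evaluate a p q n
    rewrite eval-⊕ (const a ⊕ p) q n | eval-⊕ (const a) p n | eval-const a n = refl

choose : Tree → Tree → Tree → Tree
choose nil     x y = y
choose (_ ∙ _) x y = x

-- The condition is computed beside the input, which both branches begin by restoring. Sums of
-- polynomials stand in for maxima over the branches.
if⟶ : {b : J → Tree} → e ⟶ b → e ⟶ f → e ⟶ g → e ⟶ λ j → choose (b j) (f j) (g j)
if⟶ {e = e} {f = f} {g = g} {b = b} c t d = record
  { command = command test ⨾ (if tl top then restore ⨾ command t else (restore ⨾ command d))
  ; time    = time test ⊕ const overhead ⊕ (time t ⊕ time d)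
  ; growth  = growth t ⊕ growth d
  ; run     = branch
  ; bound   = small
  }
  where
  open ≤-Reasoning
  test = input ∙⟶ c
  restore : Command 1
  restore = zero := cons (hd top) rest
  -- 4 for the test and 7 for `restore`.
  overhead = 11

  evaluate : ∀ p a q r n →
    eval (p ⊕ const a ⊕ (q ⊕ r)) n ≡ eval p n + (a + (eval q n + eval r n))
  evaluate p a q r n
    rewrite eval-⊕ (p ⊕ const a) (q ⊕ r) n | eval-⊕ p (const a) n | eval-⊕ q r n
          | eval-const a n = +-assoc (eval p n) a _

  budget : ∀ {u v} j → u ≤ eval (time test) (size (e j)) →
    v ≤ eval (time t) (size (e j)) + eval (time d) (size (e j)) →
    u + (4 + (7 + v)) ≤ eval (time test ⊕ const overhead ⊕ (time t ⊕ time d)) (size (e j))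
  budget {u} {v} j u≤ v≤ = begin
    u + (4 + (7 + v)) ≤⟨ +-mono-≤ u≤ (+-monoʳ-≤ overhead v≤) ⟩
    _                 ≡⟨ evaluate (time test) overhead (time t) (time d) (size (e j)) ⟨
    _                 ∎

  branch : ∀ j ρ → ∃[ n ]
    (_ ⊢ (e j ∙ ρ) ∷ᵛ []ᵛ ⇓ (choose (b j) (f j) (g j) ∙ ρ) ∷ᵛ []ᵛ [ n ]) × n ≤ _
  branch j ρ with b j | run test j ρ
  ... | nil | _ , test⇓ , u≤ with run d j ρ
  ...   | _ , d⇓ , v≤ = _ , seq test⇓ (if-false refl (seq assign d⇓))
                      , budget j u≤ (≤-trans v≤ (m≤n+m _ _))
  branch j ρ | _ ∙ _ | _ , test⇓ , u≤ with run t j ρ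
  ...   | _ , t⇓ , v≤ = _ , seq test⇓ (if-true (λ ()) (seq assign t⇓))
                      , budget j u≤ (≤-trans v≤ (m≤m+n _ _))

  small : ∀ j → size (choose (b j) (f j) (g j)) ≤ eval (growth t ⊕ growth d) (size (e j))
  small j rewrite eval-⊕ (growth t) (growth d) (size (e j)) with b j
  ... | nil   = ≤-trans (bound d j) (m≤n+m _ _)
  ... | _ ∙ _ = ≤-trans (bound t j) (m≤m+n _ _)

-- `grows` is additive, and its increment is bounded through the context and the item only: summed
-- over the list, this stays polynomial. `Inv` serves folds whose increment is small only for the
-- states that actually occur.
module _ {A S : J → Set} (encA : ∀ {j} → A j → Tree) (encS : ∀ {j} → S j → Tree)
  {l : ∀ j → List (A j)} {s₀ : ∀ j → S j} {step : ∀ j → S j → A j → S j}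
  (g : Polynomial)
  (Inv : ∀ j → S j → Set)
  (establish : ∀ j → Inv j (s₀ j)) (preserve : ∀ j a s → Inv j s → Inv j (step j s a))
  (grows : ∀ j a s → Inv j s →
    size (encS (step j s a)) ≤ size (encS s) + eval g (size (e j ∙ encA a)))
  (list : e ⟶ λ j → encodeList encA (l j)) (initial : e ⟶ λ j → encS (s₀ j))
  (next : (λ ((j , a , s) : Σ[ j ∈ J ] A j × S j) → e j ∙ encA a ∙ encS s) ⟶
    (λ ((j , a , s) : Σ[ j ∈ J ] A j × S j) → encS (step j s a)))
  where

  private
    -- Between rounds the top is context, remaining items, state. `unpack` puts the argument of
    -- `next` (context, first item, state) above a pair of the context and the other items, and
    -- `repack` merges the new state into that pair.
    unpack repack finish loop : Command 1
    unpack = zero := cons (cons (hd top) (cons (hd (hd (tl top))) (tl (tl top))))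
                          (cons (cons (hd top) (tl (hd (tl top)))) rest)
    repack = zero := cons (cons (hd (hd rest)) (cons (tl (hd rest)) top)) (tl rest)
    finish = zero := cons (tl (tl top)) rest
    loop   = while hd (tl top) loop (unpack ⨾ command next ⨾ repack)

    step-growth state-size step-input step-time loop-time : Polynomial
    step-growth = g ⊚ (const 1 ⊕ X ⊕ growth list)
    state-size  = growth initial ⊕ growth list ⊗ step-growth
    step-input  = const 2 ⊕ X ⊕ growth list ⊕ state-size
    step-time   = time next ⊚ step-input
    -- A round costs 5 for the test, 28 for `unpack` and 17 for `repack`, besides `next`; 14 covers
    -- the last test and `finish`.
    loop-time   = const 14 ⊕ growth list ⊗ (const 50 ⊕ step-time)

    initialize : e ⟶ λ j → e j ∙ encodeList encA (l j) ∙ encS (s₀ j)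
    initialize = input ∙⟶ list ∙⟶ initial

    module _ (j : J) where
      open ≤-Reasoning
      n L G T : ℕ
      n = size (e j)
      L = eval (growth list) n
      G = eval step-growth n
      T = eval step-time n

      size-grows : ∀ a s → Inv j s → size (encA a) ≤ L → size (encS (step j s a)) ≤ size (encS s) + G
      size-grows a s inv a≤ = ≤-trans (grows j a s inv) (+-monoʳ-≤ (size (encS s)) (begin
        eval g (1 + n + size (encA a))               ≤⟨ eval-mono g (+-monoʳ-≤ (1 + n) a≤) ⟩
        eval g (1 + n + L)                           ≡⟨ cong (eval g) evaluate ⟨
        eval g (eval (const 1 ⊕ X ⊕ growth list) n)  ≡⟨ eval-⊚ g _ n ⟨
        G                                            ∎))
        where
        evaluate : eval (const 1 ⊕ X ⊕ growth list) n ≡ 1 + n + L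
        evaluate rewrite eval-⊕ (const 1 ⊕ X) (growth list) n | eval-⊕ (const 1) X n
                       | eval-const 1 n | eval-X n = refl

      next-size : ∀ a s as k → Inv j s → size (encA a) ≤ L →
        size (encS s) + suc (length {A = A j} as) * G ≤ k →
        size (encS (step j s a)) + length as * G ≤ k
      next-size a s as k inv a≤ s≤ = begin
        size (encS (step j s a)) + length as * G   ≤⟨ +-monoˡ-≤ _ (size-grows a s inv a≤) ⟩
        size (encS s) + G + length as * G          ≡⟨ +-assoc (size (encS s)) G _ ⟩
        size (encS s) + (G + length as * G)        ≤⟨ s≤ ⟩
        k                                          ∎

      foldl-size : ∀ as s → Inv j s → All (λ a → size (encA a) ≤ L) as →
        size (encS (foldl (step j) s as)) ≤ size (encS s) + length as * G
      foldl-size []       s inv []         = m≤m+n _ 0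
      foldl-size (a ∷ as) s inv (a≤ ∷ as≤) =
        ≤-trans (foldl-size as (step j s a) (preserve j a s inv) as≤)
                (next-size a s as _ inv a≤ ≤-refl)

      -- The last hypothesis is a budget: the present size together with the growth `G` of every
      -- item to come stays below `state-size`, so one bound `T` is valid for `next` in all rounds.
      loop-run : ∀ as s ρ → Inv j s → All (λ a → size (encA a) ≤ L) as →
        size (encS s) + length as * G ≤ eval state-size n → ∃[ t ]
        (loop ⊢ ((e j ∙ encodeList encA as ∙ encS s) ∙ ρ) ∷ᵛ []ᵛ
              ⇓ ((e j ∙ nil ∙ encS (foldl (step j) s as)) ∙ ρ) ∷ᵛ []ᵛ [ t ])
        × t ≤ 5 + length as * (50 + T)
      loop-run []       s ρ inv []         s≤ = 5 , while-false refl , ≤-refl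
      loop-run (a ∷ as) s ρ inv (a≤ ∷ as≤) s≤
        with run next (j , a , s) ((e j ∙ encodeList encA as) ∙ ρ)
           | loop-run as (step j s a) ρ (preserve j a s inv) as≤ (next-size a s as _ inv a≤ s≤)
      ... | t , next⇓ , t≤ | u , loop⇓ , u≤ =
        _ , while-true nonempty (seq assign (seq next⇓ assign)) loop⇓ , (begin
          5 + (28 + (t + 17)) + u
            ≡⟨ solve 2 (λ t u → con 5 :+ (con 28 :+ (t :+ con 17)) :+ u :≡ con 50 :+ t :+ u)
                 refl t u ⟩
          50 + t + u
            ≤⟨ +-mono-≤ (+-monoʳ-≤ 50 (≤-trans t≤ step-fast)) u≤ ⟩
          50 + T + (5 + length as * (50 + T))
            ≡⟨ solve 2 (λ T r → con 50 :+ T :+ (con 5 :+ r) :≡ con 5 :+ (con 50 :+ T :+ r))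
                 refl T (length as * (50 + T)) ⟩
          5 + suc (length as) * (50 + T) ∎)
        where
        nonempty : encA a ∙ encodeList encA as ≢ nil
        nonempty ()
        evaluate : eval step-input n ≡ 2 + n + L + eval state-size n
        evaluate rewrite eval-⊕ (const 2 ⊕ X ⊕ growth list) state-size n
                       | eval-⊕ (const 2 ⊕ X) (growth list) n | eval-⊕ (const 2) X n
                       | eval-const 2 n | eval-X n = refl
        step-fast : eval (time next) (size (e j ∙ encA a ∙ encS s)) ≤ T
        step-fast = begin
          eval (time next) (1 + n + (1 + size (encA a) + size (encS s)))
            ≡⟨ cong (eval (time next))
                 (solve 3 (λ n a s → con 1 :+ n :+ (con 1 :+ a :+ s) :≡ con 2 :+ n :+ a :+ s)
                   refl n (size (encA a)) (size (encS s))) ⟩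
          eval (time next) (2 + n + size (encA a) + size (encS s))
            ≤⟨ eval-mono (time next) (+-mono-≤ (+-monoʳ-≤ (2 + n) a≤)
                 (≤-trans (m≤m+n _ _) s≤)) ⟩
          eval (time next) (2 + n + L + eval state-size n)
            ≡⟨ cong (eval (time next)) evaluate ⟨
          eval (time next) (eval step-input n)
            ≡⟨ eval-⊚ (time next) step-input n ⟨
          T ∎

      items-size : ∀ (as : List (A j)) k → size (encodeList encA as) ≤ k → All (λ a → size (encA a) ≤ k) as
      items-size []       k _   = []
      items-size (a ∷ as) k as≤ =
          ≤-trans (≤-trans (m≤m+n _ _) (n≤1+n _)) as≤
        ∷ items-size as k (≤-trans (≤-trans (m≤n+m _ _) (n≤1+n _)) as≤)

      length-size : ∀ (as : List (A j)) → length as ≤ size (encodeList encA as)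
      length-size []       = z≤n
      length-size (a ∷ as) = s≤s (≤-trans (length-size as) (m≤n+m _ _))

      l-items : All (λ a → size (encA a) ≤ L) (l j)
      l-items = items-size (l j) L (bound list j)

      l-length : length (l j) ≤ L
      l-length = ≤-trans (length-size (l j)) (bound list j)

      evaluate-state : eval state-size n ≡ eval (growth initial) n + L * G
      evaluate-state rewrite eval-⊕ (growth initial) (growth list ⊗ step-growth) n
                           | eval-⊗ (growth list) step-growth n = refl

      final-size : size (encS (s₀ j)) + length (l j) * G ≤ eval state-size n
      final-size = begin
        size (encS (s₀ j)) + length (l j) * G  ≤⟨ +-mono-≤ (bound initial j) (*-monoˡ-≤ G l-length) ⟩
        eval (growth initial) n + L * G          ≡⟨ evaluate-state ⟨
        eval state-size n                      ∎

      evaluate-time : eval (time initialize ⊕ loop-time) n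
        ≡ eval (time initialize) n + (14 + L * (50 + T))
      evaluate-time rewrite eval-⊕ (time initialize) loop-time n
                          | eval-⊕ (const 14) (growth list ⊗ (const 50 ⊕ step-time)) n
                          | eval-⊗ (growth list) (const 50 ⊕ step-time) n
                          | eval-⊕ (const 50) step-time n
                          | eval-const 14 n | eval-const 50 n = refl

      fold-run : ∀ ρ → ∃[ t ]
        (command initialize ⨾ loop ⨾ finish ⊢ (e j ∙ ρ) ∷ᵛ []ᵛ
              ⇓ (encS (foldl (step j) (s₀ j) (l j)) ∙ ρ) ∷ᵛ []ᵛ [ t ])
        × t ≤ eval (time initialize ⊕ loop-time) n
      fold-run ρ with run initialize j ρ | loop-run (l j) (s₀ j) ρ (establish j) l-items final-size
      ... | t , init⇓ , t≤ | u , loop⇓ , u≤ = _ , seq init⇓ (seq loop⇓ assign) , (begin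
        t + (u + 8)
          ≤⟨ +-mono-≤ t≤ (+-monoˡ-≤ 8 (≤-trans u≤ (+-monoʳ-≤ 5 (*-monoˡ-≤ (50 + T) l-length)))) ⟩
        eval (time initialize) n + (5 + L * (50 + T) + 8)
          ≡⟨ cong (eval (time initialize) n +_)
               (solve 1 (λ r → con 5 :+ r :+ con 8 :≡ con 13 :+ r) refl (L * (50 + T))) ⟩
        eval (time initialize) n + (13 + L * (50 + T))
          ≤⟨ +-monoʳ-≤ (eval (time initialize) n) (n≤1+n _) ⟩
        eval (time initialize) n + (14 + L * (50 + T))
          ≡⟨ evaluate-time ⟨
        eval (time initialize ⊕ loop-time) n ∎)

  foldlInv⟶ : e ⟶ λ j → encS (foldl (step j) (s₀ j) (l j))
  foldlInv⟶ = record
    { command = command initialize ⨾ loop ⨾ finish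
    ; time    = time initialize ⊕ loop-time
    ; growth  = state-size
    ; run     = fold-run
    ; bound   = λ j → ≤-trans (foldl-size j (l j) (s₀ j) (establish j) (l-items j)) (final-size j)
    }

foldl⟶ : {A S : J → Set} (encA : ∀ {j} → A j → Tree) (encS : ∀ {j} → S j → Tree)
  {l : ∀ j → List (A j)} {s₀ : ∀ j → S j} {step : ∀ j → S j → A j → S j} (g : Polynomial) →
  (∀ j a s → size (encS (step j s a)) ≤ size (encS s) + eval g (size (e j ∙ encA a))) →
  e ⟶ (λ j → encodeList encA (l j)) → e ⟶ (λ j → encS (s₀ j)) →
  (λ (j , a , s) → e j ∙ encA a ∙ encS s) ⟶ (λ (j , a , s) → encS (step j s a)) →
  e ⟶ λ j → encS (foldl (step j) (s₀ j) (l j))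
foldl⟶ encA encS g grows =
  foldlInv⟶ encA encS g (λ _ _ → ⊤) _ _ (λ j a s _ → grows j a s)

-- The local search and its implementation

-- A list with at most one entry serves as an optional value: `[]` records a mismatch, `bs ∷ []` the
-- bits still to be matched.
matchBit : List (List Bool) → Bool → List (List Bool)
matchBit []                    b     = []
matchBit ([] ∷ _)              b     = []
matchBit ((false ∷ bs) ∷ _) false = bs ∷ []
matchBit ((false ∷ bs) ∷ _) true  = []
matchBit ((true  ∷ bs) ∷ _) false = []
matchBit ((true  ∷ bs) ∷ _) true  = bs ∷ []

-- The singleton of bs without its prefix as, or [] if as is not a prefix.
remainder : List Bool → List Bool → List (List Bool)
remainder as bs = foldl matchBit (bs ∷ []) as

ifExhausted : List (List Bool) → A → A → A
ifExhausted []            x y = y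
ifExhausted ([] ∷ _)      x y = x
ifExhausted ((_ ∷ _) ∷ _) x y = y

-- Keeps one code for each run, so that the length of the result is the number of phrases in unary.
push : List (List Bool) → List Bool → List (List Bool)
push []       w = w ∷ []
push (v ∷ vs) w = ifExhausted (remainder v w) (v ∷ vs) (w ∷ v ∷ vs)

reverseConcat : List (List A) → List A
reverseConcat = foldl (λ acc xs → xs ʳ++ acc) []

_∸ˡ_ : List A → List B → List A
ys ∸ˡ xs = foldl (λ zs _ → drop 1 zs) ys xs

-- (as , zs) stands for the splitting of as ʳ++ zs before zs.
cut : B → (List A × List A) × List ((List A × B) × List A) →
  (List A × List A) × List ((List A × B) × List A)
cut b ((as , [])     , acc) = (as , []) , acc
cut b ((as , z ∷ zs) , acc) = (z ∷ as , zs) , ((z ∷ as , b) , zs) ∷ acc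

-- The fold over `zs` uses its items only as a counter; the list that is being cut travels in the
-- state.
splits : B → List A → List ((List A × B) × List A)
splits b zs = proj₂ (foldl (λ s _ → cut b s) (([] , zs) , (([] , b) , zs) ∷ []) zs)

collect : (A → List B) → List A → List B
collect f = foldl (λ acc x → f x ʳ++ acc) []

opaque
  extend : List (B × List A) → List ((List A × B) × List A)
  extend = collect (λ (b , zs) → splits b zs)

Blocks : Set → Set
Blocks A = List A × List A × List A × List A × ⊤

-- Each `extend` cuts one more block off the remaining list in all possible ways, in the order `ps`,
-- `as`, `bs`, `cs`. The unit component lets the first of these steps have the same form as the
-- others.
interchanges : List A → List (Blocks A × List A)
interchanges xs = extend (extend (extend (extend ((tt , xs) ∷ []))))

-- Both the list of blocks and every single block are in reverse.
assemble : Blocks A × List A → List A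
assemble ((cs , bs , as , ps , tt) , zs) = ps ʳ++ cs ʳ++ bs ʳ++ as ʳ++ zs

null? : List A → List B → List B → List B
null? []      ys zs = ys
null? (_ ∷ _) ys zs = zs

module Search (𝔸 : Alphabet) where
  open Alphabet 𝔸

  runs : List String → List (List Bool)
  runs xs = foldl (λ vs c → push vs (code c)) [] (reverseConcat xs)

  -- A tie keeps `xs`, so a round that saves no phrase returns its argument itself.
  better : List String → List String → List String
  better xs ys = null? (runs xs ∸ˡ runs ys) xs ys

  pick : List String → Blocks String × List String → List String
  pick xs c = better xs (assemble c)

  improve : List String → List String
  improve xs = foldl pick xs (interchanges xs)

  -- There are enough rounds, since reverseConcat xs has as many characters as
  -- xs, and the number of phrases is at most that.
  descend : List String → List String
  descend xs = foldl (λ ys _ → improve ys) xs (reverseConcat xs)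

  -- Batches of a schedule are nonempty, so without strings there must be no batch at all.
  schedule : List String → List Batch
  schedule xs = null? xs [] (descend xs ∷ [])

-- Commands for the list operations of the search

_⊗ᵉ_ : (A → Tree) → (B → Tree) → A × B → Tree
(encA ⊗ᵉ encB) (a , b) = encA a ∙ encB b

size-ʳ++ : (enc : A → Tree) (xs ys : List A) →
  size (encodeList enc (xs ʳ++ ys)) ≤ size (encodeList enc ys) + size (encodeList enc xs)
size-ʳ++ enc []       ys = m≤m+n _ 1
size-ʳ++ enc (x ∷ xs) ys = begin
  size (encodeList enc (xs ʳ++ (x ∷ ys)))         ≤⟨ size-ʳ++ enc xs (x ∷ ys) ⟩
  1 + size (enc x) + size (encodeList enc ys) + size (encodeList enc xs)
    ≡⟨ solve 3 (λ x y z → con 1 :+ x :+ y :+ z :≡ y :+ (con 1 :+ x :+ z)) refl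
         (size (enc x)) (size (encodeList enc ys)) (size (encodeList enc xs)) ⟩
  size (encodeList enc ys) + size (encodeList enc (x ∷ xs)) ∎
  where open ≤-Reasoning

size-tail : (enc : A → Tree) (xs : List A) →
  size (encodeList enc (drop 1 xs)) ≤ size (encodeList enc xs)
size-tail enc []       = ≤-refl
size-tail enc (x ∷ xs) = ≤-trans (m≤n+m _ _) (n≤1+n _)

module _ {A S : J → Set} {encA : ∀ {j} → A j → Tree} {encS : ∀ {j} → S j → Tree} where
  context⟶ : (λ ((j , a , s) : Σ[ j ∈ J ] A j × S j) → e j ∙ encA a ∙ encS s) ⟶ (λ (j , _) → e j)
  context⟶ = hd⟶ input

  item⟶ : (λ ((j , a , s) : Σ[ j ∈ J ] A j × S j) → e j ∙ encA a ∙ encS s) ⟶ (λ (_ , a , _) → encA a)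
  item⟶ = hd⟶ (tl⟶ input)

  state⟶ : (λ ((j , a , s) : Σ[ j ∈ J ] A j × S j) → e j ∙ encA a ∙ encS s) ⟶ (λ (_ , _ , s) → encS s)
  state⟶ = tl⟶ (tl⟶ input)

module _ {A : J → Set} (enc : ∀ {j} → A j → Tree) where
  ʳ++⟶ : {xs ys : ∀ j → List (A j)} →
    e ⟶ (λ j → encodeList enc (xs j)) → e ⟶ (λ j → encodeList enc (ys j)) →
    e ⟶ λ j → encodeList enc (xs j ʳ++ ys j)
  ʳ++⟶ {e = e} xs ys = foldl⟶ enc (encodeList enc) X grows xs ys (item⟶ ∙⟶ state⟶)
    where
    open ≤-Reasoning
    grows : ∀ j a s → size (encodeList enc (a ∷ s))
      ≤ size (encodeList enc s) + eval X (size (e j ∙ enc a))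
    grows j a s rewrite eval-X (size (e j ∙ enc a)) = begin
      1 + size (enc a) + size (encodeList enc s)
        ≤⟨ +-monoˡ-≤ _ (+-monoʳ-≤ 1 (m≤n+m (size (enc a)) (size (e j)))) ⟩
      size (e j ∙ enc a) + size (encodeList enc s)
        ≡⟨ +-comm _ (size (encodeList enc s)) ⟩
      size (encodeList enc s) + size (e j ∙ enc a) ∎

module _ {A : J → Set} (enc : ∀ {j} → A j → Tree) where
  reverseConcat⟶ : {xss : ∀ j → List (List (A j))} →
    e ⟶ (λ j → encodeList (encodeList enc) (xss j)) →
    e ⟶ λ j → encodeList enc (reverseConcat (xss j))
  reverseConcat⟶ {e = e} xss = foldl⟶ (encodeList enc) (encodeList enc) X grows xss nothing⟶
    (ʳ++⟶ enc item⟶ state⟶)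
    where
    open ≤-Reasoning
    grows : ∀ j xs s → size (encodeList enc (xs ʳ++ s))
      ≤ size (encodeList enc s) + eval X (size (e j ∙ encodeList enc xs))
    grows j xs s rewrite eval-X (size (e j ∙ encodeList enc xs)) =
      ≤-trans (size-ʳ++ enc xs s) (+-monoʳ-≤ _ (≤-trans (m≤n+m _ _) (n≤1+n _)))

module _ {A B : J → Set} (encA : ∀ {j} → A j → Tree) (encB : ∀ {j} → B j → Tree) where
  ∸ˡ⟶ : {xs : ∀ j → List (A j)} {ys : ∀ j → List (B j)} →
    e ⟶ (λ j → encodeList encA (xs j)) → e ⟶ (λ j → encodeList encB (ys j)) →
    e ⟶ λ j → encodeList encA (xs j ∸ˡ ys j)
  ∸ˡ⟶ {e = e} xs ys = foldl⟶ encB (encodeList encA) X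
    (λ j a s → ≤-trans (size-tail encA s) (m≤m+n _ _)) ys xs
    (tl⟶ state⟶ ≗⟶ λ { (_ , _ , []) → refl ; (_ , _ , _ ∷ _) → refl })

bits : List Bool → Tree
bits = encodeList encodeBit

matchBit⟶ : {s : J → List (List Bool)} {b : J → Bool} →
  e ⟶ encodeList bits ∘ s → e ⟶ encodeBit ∘ b → e ⟶ λ j → encodeList bits (matchBit (s j) (b j))
matchBit⟶ {s = s} {b} s⟶ b⟶ =
  if⟶ s⟶
    (if⟶ (hd⟶ s⟶)
      (if⟶ (hd⟶ (hd⟶ s⟶))
        (if⟶ b⟶ (tl⟶ (hd⟶ s⟶) ∙⟶ nothing⟶) nothing⟶)
        (if⟶ b⟶ nothing⟶ (tl⟶ (hd⟶ s⟶) ∙⟶ nothing⟶)))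
      nothing⟶)
    nothing⟶
  ≗⟶ λ j → correct (s j) (b j)
  where
  correct : ∀ s b →
    choose (encodeList bits s)
      (choose (head (encodeList bits s))
        (choose (head (head (encodeList bits s)))
          (choose (encodeBit b) (tail (head (encodeList bits s)) ∙ nil) nil)
          (choose (encodeBit b) nil (tail (head (encodeList bits s)) ∙ nil)))
        nil)
      nil
    ≡ encodeList bits (matchBit s b)
  correct []                    b     = refl
  correct ([] ∷ _)              b     = refl
  correct ((false ∷ _) ∷ _) false = refl
  correct ((false ∷ _) ∷ _) true  = refl
  correct ((true  ∷ _) ∷ _) false = refl
  correct ((true  ∷ _) ∷ _) true  = refl

size-matchBit : ∀ s b → size (encodeList bits (matchBit s b)) ≤ size (encodeList bits s)
size-matchBit []                      b     = ≤-refl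
size-matchBit ([] ∷ s)                b     = s≤s z≤n
size-matchBit ((false ∷ bs) ∷ s) false =
  +-mono-≤ (s≤s (size-tail encodeBit (false ∷ bs))) (size≥1 (encodeList bits s))
size-matchBit ((false ∷ bs) ∷ s) true  = s≤s z≤n
size-matchBit ((true  ∷ bs) ∷ s) false = s≤s z≤n
size-matchBit ((true  ∷ bs) ∷ s) true  =
  +-mono-≤ (s≤s (size-tail encodeBit (true ∷ bs))) (size≥1 (encodeList bits s))

remainder⟶ : {v w : J → List Bool} →
  e ⟶ bits ∘ v → e ⟶ bits ∘ w → e ⟶ λ j → encodeList bits (remainder (v j) (w j))
remainder⟶ v w = foldl⟶ encodeBit (encodeList bits) X
  (λ _ b s → ≤-trans (size-matchBit s b) (m≤m+n _ _)) v (w ∙⟶ nothing⟶)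
  (matchBit⟶ state⟶ item⟶)

ifExhausted⟶ : {A : J → Set} {enc : ∀ {j} → A j → Tree}
  {r : J → List (List Bool)} {x y : ∀ j → A j} →
  e ⟶ encodeList bits ∘ r → e ⟶ (λ j → enc (x j)) → e ⟶ (λ j → enc (y j)) →
  e ⟶ λ j → enc (ifExhausted (r j) (x j) (y j))
ifExhausted⟶ {enc = enc} {r} {x} {y} r⟶ x⟶ y⟶ =
  if⟶ r⟶ (if⟶ (hd⟶ r⟶) y⟶ x⟶) y⟶ ≗⟶ λ j → correct (r j) (x j) (y j)
  where
  correct : ∀ {j} r (x y : _) →
    choose (encodeList bits r) (choose (head (encodeList bits r)) (enc {j} y) (enc x)) (enc y)
    ≡ enc (ifExhausted r x y)
  correct []            x y = refl
  correct ([] ∷ _)      x y = refl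
  correct ((_ ∷ _) ∷ _) x y = refl

push⟶ : {vs : J → List (List Bool)} {w : J → List Bool} →
  e ⟶ encodeList bits ∘ vs → e ⟶ bits ∘ w → e ⟶ λ j → encodeList bits (push (vs j) (w j))
push⟶ {e = e} {vs} {w} vs⟶ w⟶ =
  if⟶ vs⟶
    (ifExhausted⟶ {enc = encodeList bits} (remainder⟶ first⟶ w⟶) vs⟶ (w⟶ ∙⟶ vs⟶))
    (w⟶ ∙⟶ nothing⟶)
  ≗⟶ λ j → correct (vs j) (w j)
  where
  first : List (List Bool) → List Bool
  first []      = []
  first (v ∷ _) = v
  first⟶ : e ⟶ λ j → bits (first (vs j))
  first⟶ = hd⟶ vs⟶ ≗⟶ λ j → head-first (vs j)
    where
    head-first : ∀ vs → head (encodeList bits vs) ≡ bits (first vs)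
    head-first []      = refl
    head-first (_ ∷ _) = refl
  correct : ∀ vs w →
    choose (encodeList bits vs)
      (encodeList bits (ifExhausted (remainder (first vs) w) vs (w ∷ vs))) (bits w ∙ nil)
    ≡ encodeList bits (push vs w)
  correct []      w = refl
  correct (_ ∷ _) w = refl

size-push : ∀ vs w →
  size (encodeList bits (push vs w)) ≤ size (encodeList bits vs) + (1 + size (bits w))
size-push []       w = ≤-reflexive (+-comm (suc (size (bits w))) 1)
size-push (v ∷ vs) w with remainder v w
... | []          = ≤-reflexive (+-comm _ (size (encodeList bits (v ∷ vs))))
... | [] ∷ _      = m≤m+n _ _
... | (_ ∷ _) ∷ _ = ≤-reflexive (+-comm _ (size (encodeList bits (v ∷ vs))))

null?⟶ : {A B : J → Set} {encA : ∀ {j} → A j → Tree} {encB : ∀ {j} → B j → Tree}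
  {xs : ∀ j → List (A j)} {ys zs : ∀ j → List (B j)} →
  e ⟶ (λ j → encodeList encA (xs j)) →
  e ⟶ (λ j → encodeList encB (ys j)) → e ⟶ (λ j → encodeList encB (zs j)) →
  e ⟶ λ j → encodeList encB (null? (xs j) (ys j) (zs j))
null?⟶ {encA = encA} {encB} {xs} {ys} {zs} xs⟶ ys⟶ zs⟶ =
  if⟶ xs⟶ zs⟶ ys⟶ ≗⟶ λ j → correct (xs j)
  where
  correct : ∀ {j} xs → choose (encodeList (encA {j}) xs) (encodeList encB (zs j)) (encodeList encB (ys j))
    ≡ encodeList encB (null? xs (ys j) (zs j))
  correct []      = refl
  correct (_ ∷ _) = refl

module _ {A B : J → Set} (encA : ∀ {j} → A j → Tree) (encB : ∀ {j} → B j → Tree) where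

  encodeCut : ∀ {j} → (List (A j) × B j) × List (A j) → Tree
  encodeCut = (encodeList encA ⊗ᵉ encB) ⊗ᵉ encodeList encA

  private
    encodeState : ∀ {j} → (List (A j) × List (A j)) × List ((List (A j) × B j) × List (A j)) → Tree
    encodeState = (encodeList encA ⊗ᵉ encodeList encA) ⊗ᵉ encodeList encodeCut

  splits⟶ : {b : ∀ j → B j} {zs : ∀ j → List (A j)} →
    e ⟶ (λ j → encB (b j)) → e ⟶ (λ j → encodeList encA (zs j)) →
    e ⟶ λ j → encodeList encodeCut (splits (b j) (zs j))
  splits⟶ {e = e} {b = b} {zs} b⟶ zs⟶ = tl⟶
    (foldlInv⟶ encA encodeState bounds Inv (λ _ → ≤-refl) preserve grows zs⟶
      ((nothing⟶ ∙⟶ zs⟶) ∙⟶ ((nothing⟶ ∙⟶ b⟶) ∙⟶ zs⟶) ∙⟶ nothing⟶)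
      (if⟶ (tl⟶ (hd⟶ state⟶))
        ((prefix ∙⟶ suffix) ∙⟶ ((prefix ∙⟶ (context⟶ ⟫ reindex proj₁ b⟶)) ∙⟶ suffix) ∙⟶ tl⟶ state⟶)
        state⟶
      ≗⟶ λ (j , _ , s) → correct j s))
    where
    State : J → Set
    State j = (List (A j) × List (A j)) × List ((List (A j) × B j) × List (A j))

    prefix : (λ ((j , a , s) : Σ[ j ∈ J ] A j × State j) → e j ∙ encA a ∙ encodeState s)
      ⟶ λ (_ , _ , s) → head (tail (head (encodeState s))) ∙ head (head (encodeState s))
    prefix = hd⟶ (tl⟶ (hd⟶ state⟶)) ∙⟶ hd⟶ (hd⟶ state⟶)

    suffix : (λ ((j , a , s) : Σ[ j ∈ J ] A j × State j) → e j ∙ encA a ∙ encodeState s)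
      ⟶ λ (_ , _ , s) → tail (tail (head (encodeState s)))
    suffix = tl⟶ (tl⟶ (hd⟶ state⟶))

    correct : ∀ j s → choose (tail (head (encodeState s)))
      (((head (tail (head (encodeState s))) ∙ head (head (encodeState s)))
          ∙ tail (tail (head (encodeState s))))
        ∙ (((head (tail (head (encodeState s))) ∙ head (head (encodeState s))) ∙ encB (b j))
          ∙ tail (tail (head (encodeState s))))
        ∙ tail (encodeState s))
      (encodeState s) ≡ encodeState (cut (b j) s)
    correct j ((as , [])    , acc) = refl
    correct j ((as , _ ∷ _) , acc) = refl

    -- A cut adds a copy of the current splitting to the output, which the single item does not
    -- bound. The two parts of the splitting, however, never exceed `zs` together; the 1 is the
    -- `nil` that ends the additional list.
    Inv : ∀ j → State j → Set
    Inv j ((as , xs) , _) =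
      size (encodeList encA as) + size (encodeList encA xs) ≤ 1 + size (encodeList encA (zs j))

    shift-size : ∀ {j} x (as xs : List (A j)) →
      size (encodeList encA (x ∷ as)) + size (encodeList encA xs)
      ≡ size (encodeList encA as) + size (encodeList encA (x ∷ xs))
    shift-size x as xs =
      solve 3 (λ x a z → con 1 :+ x :+ a :+ z :≡ a :+ (con 1 :+ x :+ z)) refl
        (size (encA x)) (size (encodeList encA as)) (size (encodeList encA xs))

    preserve : ∀ j a s → Inv j s → Inv j (cut (b j) s)
    preserve j _ ((as , [])     , _) inv = inv
    preserve j _ ((as , x ∷ xs) , _) inv = ≤-trans (≤-reflexive (shift-size x as xs)) inv

    -- 4 stands for the three new cells of a cut and the 1 in `Inv`.
    bounds : Polynomial
    bounds = const 4 ⊕ growth b⟶ ⊕ growth zs⟶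

    open ≤-Reasoning

    grows : ∀ j a s → Inv j s →
      size (encodeState (cut (b j) s)) ≤ size (encodeState s) + eval bounds (size (e j ∙ encA a))
    grows j _ ((as , [])     , acc) inv = m≤m+n _ _
    grows j a ((as , x ∷ xs) , acc) inv = begin
      1 + (1 + p + q) + (1 + (1 + (1 + p + size (encB (b j))) + q) + r)
        ≡⟨ solve 4 (λ p q b r → con 1 :+ (con 1 :+ p :+ q) :+ (con 1 :+ (con 1 :+ (con 1 :+ p :+ b) :+ q) :+ r)
                      :≡ con 1 :+ (con 1 :+ (p :+ q)) :+ r :+ (con 3 :+ b :+ (p :+ q)))
             refl p q (size (encB (b j))) r ⟩
      1 + (1 + (p + q)) + r + (3 + size (encB (b j)) + (p + q))
        ≤⟨ +-monoʳ-≤ (1 + (1 + (p + q)) + r) (+-monoʳ-≤ (3 + size (encB (b j)))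
             (preserve j a ((as , x ∷ xs) , acc) inv)) ⟩
      1 + (1 + (p + q)) + r + (3 + size (encB (b j)) + (1 + size (encodeList encA (zs j))))
        ≡⟨ cong₂ _+_
             (cong (λ m → 1 + (1 + m) + r) (shift-size x as xs))
             (+-suc (3 + size (encB (b j))) _) ⟩
      size (encodeState ((as , x ∷ xs) , acc)) + (4 + size (encB (b j)) + size (encodeList encA (zs j)))
        ≤⟨ +-monoʳ-≤ (size (encodeState ((as , x ∷ xs) , acc))) (+-mono-≤
             (+-monoʳ-≤ 4 (≤-trans (bound b⟶ j) (eval-mono (growth b⟶) larger)))
             (≤-trans (bound zs⟶ j) (eval-mono (growth zs⟶) larger))) ⟩
      size (encodeState ((as , x ∷ xs) , acc)) + (4 + eval (growth b⟶) n + eval (growth zs⟶) n)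
        ≡⟨ cong (size (encodeState ((as , x ∷ xs) , acc)) +_) evaluate ⟨
      size (encodeState ((as , x ∷ xs) , acc)) + eval bounds n ∎
      where
      n = size (e j ∙ encA a)
      p = size (encodeList encA (x ∷ as))
      q = size (encodeList encA xs)
      r = size (encodeList encodeCut acc)
      larger : size (e j) ≤ n
      larger = ≤-trans (m≤m+n _ _) (n≤1+n _)
      evaluate : eval bounds n ≡ 4 + eval (growth b⟶) n + eval (growth zs⟶) n
      evaluate rewrite eval-⊕ (const 4 ⊕ growth b⟶) (growth zs⟶) n
                     | eval-⊕ (const 4) (growth b⟶) n | eval-const 4 n = refl

module _ {A B : J → Set} (encA : ∀ {j} → A j → Tree) (encB : ∀ {j} → B j → Tree) where
  collect⟶ : {f : ∀ j → A j → List (B j)} {xs : ∀ j → List (A j)} →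
    (λ ((j , a) : Σ[ j ∈ J ] A j) → encA a) ⟶ (λ (j , a) → encodeList encB (f j a)) →
    e ⟶ (λ j → encodeList encA (xs j)) →
    e ⟶ λ j → encodeList encB (collect (f j) (xs j))
  collect⟶ {e = e} {f = f} f⟶ xs⟶ = foldl⟶ encA (encodeList encB) (growth f⟶) grows xs⟶ nothing⟶
    (ʳ++⟶ encB (item⟶ ⟫ reindex (λ (j , a , _) → j , a) f⟶) state⟶)
    where
    grows : ∀ j a s → size (encodeList encB (f j a ʳ++ s))
      ≤ size (encodeList encB s) + eval (growth f⟶) (size (e j ∙ encA a))
    grows j a s = ≤-trans (size-ʳ++ encB (f j a) s) (+-monoʳ-≤ (size (encodeList encB s))
      (≤-trans (bound f⟶ (j , a)) (eval-mono (growth f⟶)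
        (≤-trans (m≤n+m (size (encA a)) (size (e j))) (n≤1+n _)))))

module _ {A : J → Set} (enc : ∀ {j} → A j → Tree) where
  opaque
    unfolding extend
    extend⟶ : {B : J → Set} {encB : ∀ {j} → B j → Tree} {cs : ∀ j → List (B j × List (A j))} →
      e ⟶ (λ j → encodeList (encB ⊗ᵉ encodeList enc) (cs j)) →
      e ⟶ λ j → encodeList (encodeCut {A = A} {B = B} enc encB {j}) (extend (cs j))
    extend⟶ {B = B} {encB = encB} = collect⟶
      {A = λ j → B j × List (A j)} {B = λ j → (List (A j) × B j) × List (A j)}
      (encB ⊗ᵉ encodeList enc) (λ {j} → encodeCut {A = A} {B = B} enc encB {j})
      (splits⟶ enc encB (hd⟶ input) (tl⟶ input))

  encodeUnit : ⊤ → Tree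
  encodeUnit _ = nil

  encodeBlocks : ∀ {j} → Blocks (A j) → Tree
  encodeBlocks =
    encodeList enc ⊗ᵉ (encodeList enc ⊗ᵉ (encodeList enc ⊗ᵉ (encodeList enc ⊗ᵉ encodeUnit)))

  interchanges⟶ : {xs : ∀ j → List (A j)} → e ⟶ (λ j → encodeList enc (xs j)) →
    e ⟶ λ j → encodeList (encodeBlocks ⊗ᵉ encodeList enc) (interchanges (xs j))
  interchanges⟶ xs⟶ =
    extend⟶ {B = λ j → List (A j) × List (A j) × List (A j) × ⊤}
      (extend⟶ {B = λ j → List (A j) × List (A j) × ⊤}
        (extend⟶ {B = λ j → List (A j) × ⊤}
          (extend⟶ {B = λ _ → ⊤} {encB = encodeUnit} ((nothing⟶ ∙⟶ xs⟶) ∙⟶ nothing⟶))))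

  assemble⟶ : {c : ∀ j → Blocks (A j) × List (A j)} →
    e ⟶ (λ j → (encodeBlocks ⊗ᵉ encodeList enc) (c j)) →
    e ⟶ λ j → encodeList enc (assemble (c j))
  assemble⟶ c⟶ =
    ʳ++⟶ enc (hd⟶ (tl⟶ (tl⟶ (tl⟶ (hd⟶ c⟶)))))
      (ʳ++⟶ enc (hd⟶ (hd⟶ c⟶))
        (ʳ++⟶ enc (hd⟶ (tl⟶ (hd⟶ c⟶)))
          (ʳ++⟶ enc (hd⟶ (tl⟶ (tl⟶ (hd⟶ c⟶)))) (tl⟶ c⟶))))

-- Local optimality of the result

∈-ʳ++⁻ : ∀ (xs : List A) {ys y} → y ∈ xs ʳ++ ys → y ∈ xs ⊎ y ∈ ys
∈-ʳ++⁻ []       y∈ = inj₂ y∈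
∈-ʳ++⁻ (x ∷ xs) y∈ with ∈-ʳ++⁻ xs y∈
... | inj₁ y∈xs         = inj₁ (there y∈xs)
... | inj₂ (here refl)  = inj₁ (here refl)
... | inj₂ (there y∈ys) = inj₂ y∈ys

∈-ʳ++⁺ʳ : ∀ (xs : List A) {ys y} → y ∈ ys → y ∈ xs ʳ++ ys
∈-ʳ++⁺ʳ []       y∈ = y∈
∈-ʳ++⁺ʳ (x ∷ xs) y∈ = ∈-ʳ++⁺ʳ xs (there y∈)

∈-ʳ++⁺ˡ : ∀ {xs ys} {y : A} → y ∈ xs → y ∈ xs ʳ++ ys
∈-ʳ++⁺ˡ {xs = x ∷ xs} (here refl) = ∈-ʳ++⁺ʳ xs (here refl)
∈-ʳ++⁺ˡ               (there y∈)  = ∈-ʳ++⁺ˡ y∈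

foldl-invariant : ∀ (P : B → Set) {f : B → A → B} {b} xs →
  P b → (∀ {b x} → x ∈ xs → P b → P (f b x)) → P (foldl f b xs)
foldl-invariant P []       pb step = pb
foldl-invariant P (x ∷ xs) pb step =
  foldl-invariant P xs (step (here refl) pb) (step ∘ there)

∈-collect⁻ : ∀ (f : A → List B) xs {y} → y ∈ collect f xs → ∃[ x ] x ∈ xs × y ∈ f x
∈-collect⁻ f xs = foldl-invariant (λ acc → ∀ {y} → y ∈ acc → ∃[ x ] x ∈ xs × y ∈ f x) xs (λ ()) step
  where
  step : ∀ {acc x} → x ∈ xs → (∀ {y} → y ∈ acc → ∃[ x ] x ∈ xs × y ∈ f x) →
    ∀ {y} → y ∈ f x ʳ++ acc → ∃[ x ] x ∈ xs × y ∈ f x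
  step {x = x} x∈ acc⊆ y∈ with ∈-ʳ++⁻ (f x) y∈
  ... | inj₁ y∈fx  = x , x∈ , y∈fx
  ... | inj₂ y∈acc = acc⊆ y∈acc

∈-collect⁺ : ∀ (f : A → List B) {xs x y} → x ∈ xs → y ∈ f x → y ∈ collect f xs
∈-collect⁺ f {xs} = go xs
  where
  go : ∀ xs {acc x y} → x ∈ xs → y ∈ f x → y ∈ foldl (λ acc x → f x ʳ++ acc) acc xs
  go (_ ∷ xs) (here refl) y∈ =
    foldl-invariant (_ ∈_) xs (∈-ʳ++⁺ˡ y∈) (λ {_} {x} _ → ∈-ʳ++⁺ʳ (f x))
  go (_ ∷ xs) (there x∈)  y∈ = go xs x∈ y∈

∈-splits⁻ : ∀ (b : B) (zs : List A) {as b′ zs′} →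
  ((as , b′) , zs′) ∈ splits b zs → as ʳ++ zs′ ≡ zs × b′ ≡ b
∈-splits⁻ {B = B} {A = A} b zs = proj₂ (foldl-invariant Sound zs
    (refl , λ { (here refl) → refl , refl })
    (λ {s} → step {s}))
  where
  Sound : (List A × List A) × List ((List A × B) × List A) → Set
  Sound ((as , xs) , acc) = as ʳ++ xs ≡ zs ×
    (∀ {as b′ zs′} → ((as , b′) , zs′) ∈ acc → as ʳ++ zs′ ≡ zs × b′ ≡ b)
  step : ∀ {s x} → x ∈ zs → Sound s → Sound (cut b s)
  step {(as , [])     , acc} _ sound          = sound
  step {(as , x ∷ xs) , acc} _ (split , acc⊆) =
    split , λ { (here refl) → split , refl ; (there c∈) → acc⊆ c∈ }

∈-splits⁺ : ∀ (b : B) (as zs : List A) → ((as ʳ++ [] , b) , zs) ∈ splits b (as ++ zs)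
∈-splits⁺ {B = B} {A = A} b as zs = go as [] (here refl)
  where
  State = (List A × List A) × List ((List A × B) × List A)
  keeps : ∀ {c} {s : State} → c ∈ proj₂ s → c ∈ proj₂ (cut b s)
  keeps {s = (_ , [])    , _} c∈ = c∈
  keeps {s = (_ , _ ∷ _) , _} c∈ = there c∈
  go : ∀ as bs {acc} → ((bs , b) , as ++ zs) ∈ acc →
    ((as ʳ++ bs , b) , zs) ∈ proj₂ (foldl (λ s _ → cut b s) ((bs , as ++ zs) , acc) (as ++ zs))
  go []       bs c∈ = foldl-invariant (λ s → _ ∈ proj₂ s) zs c∈ (λ {s} _ → keeps {s = s})
  go (a ∷ as) bs c∈ = go as (a ∷ bs) (here refl)

opaque
  unfolding extend

  ∈-extend⁻ : ∀ {cs : List (B × List A)} {as b zs} → ((as , b) , zs) ∈ extend cs → (b , as ʳ++ zs) ∈ cs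
  ∈-extend⁻ {cs = cs} c∈ with ∈-collect⁻ _ cs c∈
  ... | (b , zs) , b∈ , c∈ with ∈-splits⁻ b zs c∈
  ...   | refl , refl = b∈

  ∈-extend⁺ : ∀ {cs : List (B × List A)} {b} as {zs} →
    (b , as ++ zs) ∈ cs → ((as ʳ++ [] , b) , zs) ∈ extend cs
  ∈-extend⁺ as b∈ = ∈-collect⁺ (λ (b , zs) → splits b zs) b∈ (∈-splits⁺ _ as _)

ʳ++⁺ : ∀ (xs : List A) {ys zs} → ys ↭ zs → xs ʳ++ ys ↭ xs ʳ++ zs
ʳ++⁺ []       ys↭zs = ys↭zs
ʳ++⁺ (x ∷ xs) ys↭zs = ʳ++⁺ xs (prep x ys↭zs)

ʳ++-shifts : ∀ (xs ys : List A) zs → xs ʳ++ ys ʳ++ zs ↭ ys ʳ++ xs ʳ++ zs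
ʳ++-shifts xs ys zs = begin
  xs ʳ++ ys ʳ++ zs                ≡⟨ ʳ++-defn xs ⟩
  reverse xs ++ ys ʳ++ zs         ≡⟨ cong (reverse xs ++_) (ʳ++-defn ys) ⟩
  reverse xs ++ reverse ys ++ zs  ↭⟨ shifts (reverse xs) (reverse ys) ⟩
  reverse ys ++ reverse xs ++ zs  ≡⟨ cong (reverse ys ++_) (ʳ++-defn xs) ⟨
  reverse ys ++ xs ʳ++ zs         ≡⟨ ʳ++-defn ys ⟨
  ys ʳ++ xs ʳ++ zs                ∎
  where open PermutationReasoning

assemble-↭ : ∀ {xs : List A} {c} → c ∈ interchanges xs → assemble c ↭ xs
assemble-↭ {c = (cs , bs , as , ps , tt) , zs} c∈
  with ∈-extend⁻ (∈-extend⁻ (∈-extend⁻ (∈-extend⁻ c∈)))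
... | here refl = ʳ++⁺ ps (begin
  cs ʳ++ bs ʳ++ as ʳ++ zs  ↭⟨ ʳ++-shifts cs bs (as ʳ++ zs) ⟩
  bs ʳ++ cs ʳ++ as ʳ++ zs  ↭⟨ ʳ++⁺ bs (ʳ++-shifts cs as zs) ⟩
  bs ʳ++ as ʳ++ cs ʳ++ zs  ↭⟨ ʳ++-shifts bs as (cs ʳ++ zs) ⟩
  as ʳ++ bs ʳ++ cs ʳ++ zs  ∎)
  where open PermutationReasoning

∈-interchanges : ∀ (ps as bs cs : List A) zs →
  ∃[ c ] c ∈ interchanges (ps ++ as ++ bs ++ cs ++ zs)
       × assemble c ≡ ps ++ cs ++ bs ++ as ++ zs
∈-interchanges ps as bs cs zs =
  _ , ∈-extend⁺ cs (∈-extend⁺ bs (∈-extend⁺ as (∈-extend⁺ ps (here refl)))) , (begin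
    (ps ʳ++ []) ʳ++ (cs ʳ++ []) ʳ++ (bs ʳ++ []) ʳ++ (as ʳ++ []) ʳ++ zs
      ≡⟨ ʳ++-ʳ++ ps ⟩
    ps ++ (cs ʳ++ []) ʳ++ (bs ʳ++ []) ʳ++ (as ʳ++ []) ʳ++ zs
      ≡⟨ cong (ps ++_) (ʳ++-ʳ++ cs) ⟩
    ps ++ cs ++ (bs ʳ++ []) ʳ++ (as ʳ++ []) ʳ++ zs
      ≡⟨ cong (λ r → ps ++ cs ++ r) (ʳ++-ʳ++ bs) ⟩
    ps ++ cs ++ bs ++ (as ʳ++ []) ʳ++ zs
      ≡⟨ cong (λ r → ps ++ cs ++ bs ++ r) (ʳ++-ʳ++ as) ⟩
    ps ++ cs ++ bs ++ as ++ zs ∎)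
  where open ≡-Reasoning

-- The outcome is described by its effect in `ifExhausted`, the only way in which remainders are
-- used.
data Comparison (v w : List Bool) (r : List (List Bool)) : Set₁ where
  same      : v ≡ w → (∀ {A : Set} (x y : A) → ifExhausted r x y ≡ x) → Comparison v w r
  different : v ≢ w → (∀ {A : Set} (x y : A) → ifExhausted r x y ≡ y) → Comparison v w r

remainder-compares : ∀ v w → Comparison v w (remainder v w)
remainder-compares []      []      = same refl λ _ _ → refl
remainder-compares []      (_ ∷ _) = different (λ ()) λ _ _ → refl
remainder-compares (a ∷ v) w       = go a w
  where
  mismatch : ∀ v → foldl matchBit [] v ≡ []
  mismatch []      = refl
  mismatch (_ ∷ v) = mismatch v
  matches : ∀ b {w} → Comparison v w (remainder v w) → Comparison (b ∷ v) (b ∷ w) (remainder v w)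
  matches b (same refl eq)    = same refl eq
  matches b (different v≢ eq) = different (v≢ ∘ ∷-injectiveʳ) eq
  go : ∀ a w → Comparison (a ∷ v) w (remainder (a ∷ v) w)
  go a     []          rewrite mismatch v = different (λ ()) λ _ _ → refl
  go false (false ∷ w) = matches false (remainder-compares v w)
  go false (true  ∷ w) rewrite mismatch v = different (λ ()) λ _ _ → refl
  go true  (false ∷ w) rewrite mismatch v = different (λ ()) λ _ _ → refl
  go true  (true  ∷ w) = matches true (remainder-compares v w)

reverseConcat-concat : ∀ (xss : List (List A)) → reverseConcat xss ≡ reverse (concat xss)
reverseConcat-concat xss = go xss []
  where
  go : ∀ xss acc → foldl (λ acc xs → xs ʳ++ acc) acc xss ≡ concat xss ʳ++ acc
  go []         acc = refl
  go (xs ∷ xss) acc = ≡-trans (go xss (xs ʳ++ acc)) (sym (++-ʳ++ xs))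

length-∸ˡ : ∀ (xs : List A) (ys : List B) → length (xs ∸ˡ ys) ≡ length xs ∸ length ys
length-∸ˡ xs       []       = refl
length-∸ˡ []       (y ∷ ys) = ≡-trans (length-∸ˡ [] ys) (0∸n≡0 (length ys))
length-∸ˡ (x ∷ xs) (y ∷ ys) = length-∸ˡ xs ys

module Descent (𝔸 : Alphabet) where
  open Alphabet 𝔸
  open Search 𝔸

  -- As `code` is injective, comparing codes finds the same runs as comparing characters; only the
  -- multiplicities are forgotten.
  push-prepend : ∀ c ps → push (map (code ∘ proj₁) ps) (code c) ≡ map (code ∘ proj₁) (prepend c ps)
  push-prepend c []             = refl
  push-prepend c ((d , n) ∷ ps) with c ≟ d | remainder-compares (code d) (code c)
  ... | yes refl | same _ eq       = eq _ _
  ... | yes refl | different d≢c _ = contradiction refl d≢c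
  ... | no  c≢d  | same d≡c _      = contradiction (code-injective (sym d≡c)) c≢d
  ... | no  _    | different _ eq  = eq _ _

  runs-encoding : ∀ xs → runs xs ≡ map (code ∘ proj₁) (runLengthEncoding (concat xs))
  runs-encoding xs = begin
    foldl (λ vs c → push vs (code c)) [] (reverseConcat xs)
      ≡⟨ cong (foldl _ []) (reverseConcat-concat xs) ⟩
    foldl (λ vs c → push vs (code c)) [] (reverse (concat xs))
      ≡⟨ reverse-foldl _ [] (concat xs) ⟩
    foldr (λ c vs → push vs (code c)) [] (concat xs)
      ≡⟨ go (concat xs) ⟩
    map (code ∘ proj₁) (runLengthEncoding (concat xs)) ∎
    where
    open ≡-Reasoning
    go : ∀ s → foldr (λ c vs → push vs (code c)) [] s ≡ map (code ∘ proj₁) (runLengthEncoding s)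
    go []      = refl
    go (c ∷ s) = ≡-trans (cong (λ vs → push vs (code c)) (go s)) (push-prepend c (runLengthEncoding s))

  length-runs : ∀ xs → length (runs xs) ≡ phrases xs
  length-runs xs = ≡-trans (cong length (runs-encoding xs)) (length-map _ (runLengthEncoding (concat xs)))

  null?-split : ∀ {A B : Set} (xs : List A) {ys zs : List B} →
    (null? xs ys zs ≡ ys × length xs ≡ 0) ⊎ (null? xs ys zs ≡ zs × length xs ≢ 0)
  null?-split []      = inj₁ (refl , refl)
  null?-split (_ ∷ _) = inj₂ (refl , λ ())

  better-split : ∀ xs ys →
    (better xs ys ≡ xs × phrases xs ≤ phrases ys) ⊎ (better xs ys ≡ ys × phrases ys < phrases xs)
  better-split xs ys
    with null?-split (runs xs ∸ˡ runs ys) {xs} {ys}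
       | ≡-trans (length-∸ˡ (runs xs) (runs ys)) (cong₂ _∸_ (length-runs xs) (length-runs ys))
  ... | inj₁ (eq , zero≡) | len = inj₁ (eq , m∸n≡0⇒m≤n (≡-trans (sym len) zero≡))
  ... | inj₂ (eq , zero≢) | len = inj₂ (eq , ≰⇒> λ ≤ → zero≢ (≡-trans len (m≤n⇒m∸n≡0 ≤)))

  -- The first component tells the rounds apart: either the order itself is unchanged, and will be
  -- in all later rounds, or a phrase is saved.
  pick-best : ∀ cs xs → let ys = foldl pick xs cs in
    (ys ≡ xs ⊎ phrases ys < phrases xs) × phrases ys ≤ phrases xs
    × (∀ {c} → c ∈ cs → phrases ys ≤ phrases (assemble c))
  pick-best []       xs = inj₁ refl , ≤-refl , λ ()
  pick-best (c ∷ cs) xs with pick xs c | better-split xs (assemble c) | pick-best cs (pick xs c)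
  ... | _ | inj₁ (refl , xs≤) | change , ≤xs , least =
    change , ≤xs , λ { (here refl) → ≤-trans ≤xs xs≤ ; (there c∈) → least c∈ }
  ... | _ | inj₂ (refl , <xs) | change , ≤c , least =
    inj₂ (≤-<-trans ≤c <xs) , ≤-trans ≤c (<⇒≤ <xs) , λ { (here refl) → ≤c ; (there c∈) → least c∈ }

  improve-↭ : ∀ xs → improve xs ↭ xs
  improve-↭ xs = foldl-invariant (_↭ xs) (interchanges xs) ↭-refl step
    where
    step : ∀ {ys c} → c ∈ interchanges xs → ys ↭ xs → pick ys c ↭ xs
    step {ys} {c} c∈ ys↭ with better-split ys (assemble c)
    ... | inj₁ (eq , _) = ↭-trans (↭-reflexive eq) ys↭
    ... | inj₂ (eq , _) = ↭-trans (↭-reflexive eq) (assemble-↭ c∈)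

  LocallyOptimal : List String → Set
  LocallyOptimal xs = ∀ ps as bs cs {zs} → xs ≡ ps ++ as ++ bs ++ cs ++ zs →
    phrases xs ≤ phrases (ps ++ cs ++ bs ++ as ++ zs)

  improve-progress : ∀ xs → (improve xs ≡ xs × LocallyOptimal xs) ⊎ phrases (improve xs) < phrases xs
  improve-progress xs with pick-best (interchanges xs) xs
  ... | inj₂ less , _ , _     = inj₂ less
  ... | inj₁ eq   , _ , least = inj₁ (eq , optimal)
    where
    optimal : LocallyOptimal xs
    optimal ps as bs cs {zs} refl with ∈-interchanges ps as bs cs zs
    ... | c , c∈ , c≡ = subst (λ ys → phrases (ps ++ as ++ bs ++ cs ++ zs) ≤ phrases ys) c≡
                          (subst (λ ys → phrases ys ≤ phrases (assemble c)) eq (least c∈))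

  descend-↭ : ∀ xs → descend xs ↭ xs
  descend-↭ xs = foldl-invariant (_↭ xs) (reverseConcat xs) ↭-refl
    (λ {ys} _ ys↭ → ↭-trans (improve-↭ ys) ys↭)

  length-prepend : ∀ c ps → length (prepend c ps) ≤ suc (length ps)
  length-prepend c []             = ≤-refl
  length-prepend c ((d , n) ∷ ps) with c ≟ d
  ... | yes _ = n≤1+n _
  ... | no  _ = ≤-refl

  phrases-length : ∀ s → length (runLengthEncoding s) ≤ length s
  phrases-length []      = z≤n
  phrases-length (c ∷ s) = ≤-trans (length-prepend c (runLengthEncoding s)) (s≤s (phrases-length s))

  descend-optimal : ∀ xs → LocallyOptimal (descend xs)
  descend-optimal xs = go (reverseConcat xs) xs
    (≤-trans (phrases-length (concat xs))
      (≤-reflexive (≡-trans (sym (length-reverse (concat xs)))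
        (cong length (sym (reverseConcat-concat xs))))))
    where
    fixed : ∀ {A : Set} (as : List A) {xs} → improve xs ≡ xs → foldl (λ ys _ → improve ys) xs as ≡ xs
    fixed []       eq = refl
    fixed (_ ∷ as) eq rewrite eq = fixed as eq
    go : ∀ {A : Set} (as : List A) xs → phrases xs ≤ length as →
      LocallyOptimal (foldl (λ ys _ → improve ys) xs as)
    -- No round is left, but then there is no phrase either, and nothing can be saved.
    go []       xs ≤0 _ _ _ _ _ = ≤-trans ≤0 z≤n
    go (a ∷ as) xs ≤n with improve-progress xs
    ... | inj₁ (eq , optimal) = subst LocallyOptimal (sym (fixed (a ∷ as) eq)) optimal
    ... | inj₂ less           = go as (improve xs) (≤-pred (≤-trans less ≤n))

-- Commands for the search over varying alphabets

size-↭ : (enc : A → Tree) {xs ys : List A} → xs ↭ ys →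
  size (encodeList enc xs) ≡ size (encodeList enc ys)
size-↭ enc refl         = refl
size-↭ enc (prep x p)   = cong (λ n → 1 + size (enc x) + n) (size-↭ enc p)
size-↭ enc {ys = _ ∷ _ ∷ ys} (swap x y p) rewrite size-↭ enc p =
  solve 3 (λ x y n → con 1 :+ x :+ (con 1 :+ y :+ n) :≡ con 1 :+ y :+ (con 1 :+ x :+ n))
    refl (size (enc x)) (size (enc y)) (size (encodeList enc ys))
size-↭ enc (trans p q)  = ≡-trans (size-↭ enc p) (size-↭ enc q)

module _ (alphabet : J → Alphabet) where
  private
    Str : J → Set
    Str j = Alphabet.String (alphabet j)
    char : ∀ {j} → Alphabet.Char (alphabet j) → Tree
    char {j} c = bits (Alphabet.code (alphabet j) c)
    str : ∀ {j} → Str j → Tree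
    str {j} = encodeString (alphabet j)

  runs⟶ : {xs : ∀ j → List (Str j)} → e ⟶ (λ j → encodeList (str {j}) (xs j)) →
    e ⟶ λ j → encodeList bits (Search.runs (alphabet j) (xs j))
  runs⟶ {e = e} xs⟶ = foldl⟶ (λ {j} → char {j}) (encodeList bits) (const 1 ⊕ X)
    grows (reverseConcat⟶ (λ {j} → char {j}) xs⟶) nothing⟶ (push⟶ state⟶ item⟶)
    where
    grows : ∀ j c vs → size (encodeList bits (push vs (Alphabet.code (alphabet j) c)))
      ≤ size (encodeList bits vs) + eval (const 1 ⊕ X) (size (e j ∙ char {j} c))
    grows j c vs rewrite eval-⊕ (const 1) X (size (e j ∙ char {j} c))
                       | eval-const 1 (size (e j ∙ char {j} c)) | eval-X (size (e j ∙ char {j} c)) =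
      ≤-trans (size-push vs (Alphabet.code (alphabet j) c))
        (+-monoʳ-≤ (size (encodeList bits vs)) (s≤s (≤-trans (m≤n+m _ (size (e j))) (n≤1+n _))))

  better⟶ : {xs ys : ∀ j → List (Str j)} →
    e ⟶ (λ j → encodeList (str {j}) (xs j)) → e ⟶ (λ j → encodeList (str {j}) (ys j)) →
    e ⟶ λ j → encodeList (str {j}) (Search.better (alphabet j) (xs j) (ys j))
  better⟶ xs⟶ ys⟶ = null?⟶ (∸ˡ⟶ bits bits (runs⟶ xs⟶) (runs⟶ ys⟶)) xs⟶ ys⟶

module _ (alphabet : J → Alphabet) where
  private
    Str : J → Set
    Str j = Alphabet.String (alphabet j)
    str : ∀ {j} → Str j → Tree
    str {j} = encodeString (alphabet j)
    encodeCandidate : ∀ {j} → Blocks (Str j) × List (Str j) → Tree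
    encodeCandidate {j} = encodeBlocks {A = Str} (λ {j} → str {j}) {j} ⊗ᵉ encodeList (str {j})

  -- A pick is either the old state or the assembled candidate, so the sum of the two sizes gives
  -- the additive bound.
  improve⟶ : {xs : ∀ j → List (Str j)} → e ⟶ (λ j → encodeList (str {j}) (xs j)) →
    e ⟶ λ j → encodeList (str {j}) (Search.improve (alphabet j) (xs j))
  improve⟶ {e = e} xs⟶ = foldl⟶ (λ {j} → encodeCandidate {j}) (λ {j} → encodeList (str {j}))
    (growth candidate) grows (interchanges⟶ (λ {j} → str {j}) xs⟶) xs⟶
    (better⟶ (alphabet ∘ proj₁) state⟶ (item⟶ ⟫ reindex (λ (j , c , _) → j , c) candidate))
    where
    candidate : (λ ((j , c) : Σ[ j ∈ J ] (Blocks (Str j) × List (Str j))) → encodeCandidate {j} c)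
      ⟶ (λ (j , c) → encodeList (str {j}) (assemble c))
    candidate = assemble⟶ (λ {(j , _)} → str {j}) input
    grows : ∀ j c xs → size (encodeList (str {j}) (Search.pick (alphabet j) xs c))
      ≤ size (encodeList (str {j}) xs) + eval (growth candidate) (size (e j ∙ encodeCandidate {j} c))
    grows j c xs with Descent.better-split (alphabet j) xs (assemble c)
    ... | inj₁ (eq , _) rewrite eq = m≤m+n _ _
    ... | inj₂ (eq , _) rewrite eq = ≤-trans (bound candidate (j , c))
      (≤-trans (eval-mono (growth candidate) (≤-trans (m≤n+m _ (size (e j))) (n≤1+n _))) (m≤n+m _ _))

module _ (alphabet : J → Alphabet) where
  private
    Str : J → Set
    Str j = Alphabet.String (alphabet j)
    char : ∀ {j} → Alphabet.Char (alphabet j) → Tree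
    char {j} c = bits (Alphabet.code (alphabet j) c)
    str : ∀ {j} → Str j → Tree
    str {j} = encodeString (alphabet j)

  descend⟶ : {xs : ∀ j → List (Str j)} → e ⟶ (λ j → encodeList (str {j}) (xs j)) →
    e ⟶ λ j → encodeList (str {j}) (Search.descend (alphabet j) (xs j))
  descend⟶ xs⟶ = foldl⟶ (λ {j} → char {j}) (λ {j} → encodeList (str {j})) X
    -- A round permutes the strings and so preserves the size; the general growth bound of
    -- `improve⟶` would compound over the rounds.
    (λ j _ xs → ≤-trans (≤-reflexive (size-↭ (str {j}) (Descent.improve-↭ (alphabet j) xs))) (m≤m+n _ _))
    (reverseConcat⟶ (λ {j} → char {j}) xs⟶) xs⟶ (improve⟶ (alphabet ∘ proj₁) state⟶)

  schedule⟶ : {xs : ∀ j → List (Str j)} → e ⟶ (λ j → encodeList (str {j}) (xs j)) →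
    e ⟶ λ j → encodeList (encodeList (str {j})) (Search.schedule (alphabet j) (xs j))
  schedule⟶ xs⟶ = null?⟶ xs⟶ nothing⟶ (descend⟶ xs⟶ ∙⟶ nothing⟶)

-- The 7 in the time bound pays 4 for placing the input on an empty stack and 3 for taking the
-- result off it.
toProgram : e ⟶ f → Program
toProgram c = record
  { locals = 0
  ; body   = (zero := cons stack nil) ⨾ command c ⨾ (zero := top)
  }

toProgram-computes : (c : e ⟶ f) → ∀ j → ∃[ t ] (Computes toProgram c from e j to f j after t)
  × t ≤ eval (const 7 ⊕ time c) (size (e j))
toProgram-computes {e = e} c j with run c j nil
... | t , c⇓ , t≤ = _ , (_ , seq assign (seq c⇓ assign) , refl) , (begin
  4 + (t + 3)                     ≡⟨ solve 1 (λ t → con 4 :+ (t :+ con 3) :≡ con 7 :+ t) refl t ⟩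
  7 + t                           ≤⟨ +-monoʳ-≤ 7 t≤ ⟩
  7 + eval (time c) n             ≡⟨ cong (_+ eval (time c) n) (eval-const 7 n) ⟨
  eval (const 7) n + eval (time c) n ≡⟨ eval-⊕ (const 7) (time c) n ⟨
  eval (const 7 ⊕ time c) n       ∎)
  where
  open ≤-Reasoning
  n = size (e j)

-- Minimal trail decompositions of directed multigraphs

pigeonhole : ∀ {xs ys : List A} → Unique xs → xs ⊆ ys → length xs ≤ length ys
pigeonhole []             xs⊆ys = z≤n
pigeonhole {xs = x ∷ xs} (x∉xs ∷ unique) xs⊆ys with ∈-∃++ (xs⊆ys (here refl))
... | ys , zs , refl = begin
  suc (length xs)           ≤⟨ s≤s (pigeonhole unique avoid) ⟩
  suc (length (ys ++ zs))   ≡⟨ cong suc (length-++ ys) ⟩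
  suc (length ys + length zs) ≡⟨ +-suc (length ys) (length zs) ⟨
  length ys + suc (length zs) ≡⟨ length-++ ys ⟨
  length (ys ++ x ∷ zs)     ∎
  where
  open ≤-Reasoning
  avoid : xs ⊆ ys ++ zs
  avoid y∈xs with ∈-++⁻ ys (xs⊆ys (there y∈xs))
  ... | inj₁ y∈ys         = ∈-++⁺ˡ y∈ys
  ... | inj₂ (here refl)  = contradiction refl (All.lookup x∉xs y∈xs)
  ... | inj₂ (there y∈zs) = ∈-++⁺ʳ ys y∈zs

allPairs-splits : ∀ {R : A → A → Set} l →
  (∀ xs {x} ys {y} {zs} → l ≡ xs ++ x ∷ ys ++ y ∷ zs → R x y) → AllPairs R l
allPairs-splits []      r = []
allPairs-splits {R = R} (x ∷ l) r =
  All.tabulate related ∷ allPairs-splits l (λ xs ys eq → r (x ∷ xs) ys (cong (x ∷_) eq))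
  where
  related : ∀ {y} → y ∈ l → R x y
  related y∈ with ∈-∃++ y∈
  ... | ys , zs , refl = r [] ys refl

allPairs-lookup : ∀ {R : A → A → Set} {l x y} → Symmetric R → AllPairs R l →
  x ∈ l → y ∈ l → x ≡ y ⊎ R x y
allPairs-lookup R-sym (r ∷ rs) (here refl) (here refl) = inj₁ refl
allPairs-lookup R-sym (r ∷ rs) (here refl) (there y∈)  = inj₂ (All.lookup r y∈)
allPairs-lookup R-sym (r ∷ rs) (there x∈)  (here refl) = inj₂ (R-sym (All.lookup r x∈))
allPairs-lookup R-sym (r ∷ rs) (there x∈)  (there y∈)  = allPairs-lookup R-sym rs x∈ y∈

∈-mapMaybe⁺ : ∀ (f : A → Maybe B) {xs x y} → x ∈ xs → f x ≡ just y → y ∈ mapMaybe f xs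
∈-mapMaybe⁺ f {x ∷ xs} (here refl) eq rewrite eq = here refl
∈-mapMaybe⁺ f {x ∷ xs} (there x∈)  eq with f x
... | just _  = there (∈-mapMaybe⁺ f x∈ eq)
... | nothing = ∈-mapMaybe⁺ f x∈ eq

+-mono₂-≤ : ∀ {a b c d a′ b′ c′ d′} → a + c ≤ b + d → a′ + c′ ≤ b′ + d′ →
  (a + a′) + (c + c′) ≤ (b + b′) + (d + d′)
+-mono₂-≤ {a} {b} {c} {d} {a′} {b′} {c′} {d′} p q = begin
  (a + a′) + (c + c′)  ≡⟨ interchange a a′ c c′ ⟩
  (a + c) + (a′ + c′)  ≤⟨ +-mono-≤ p q ⟩
  (b + d) + (b′ + d′)  ≡⟨ interchange b d b′ d′ ⟩
  (b + b′) + (d + d′)  ∎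
  where
  open ≤-Reasoning
  open Algebra.Properties.CommutativeSemigroup +-commutativeSemigroup using (interchange)

module Multigraph {V E : Set} (_≟_ : DecidableEquality V) (src tgt : E → V) where
  open DecMembership _≟_ using (_∈?_)

  private variable
    v w x : V
    es fs : List E

  breaksAfter : V → List E → ℕ
  breaksAfter v []       = 0
  breaksAfter v (e ∷ es) with v ≟ src e
  ... | yes _ = breaksAfter (tgt e) es
  ... | no  _ = suc (breaksAfter (tgt e) es)

  trailCount : List E → ℕ
  trailCount []       = 0
  trailCount (e ∷ es) = suc (breaksAfter (tgt e) es)

  data Path : V → List E → V → Set where
    []  : Path v [] v
    _∷_ : ∀ {e} → src e ≡ v → Path (tgt e) es w → Path v (e ∷ es) w

  _++ᵖ_ : Path v es w → Path w fs x → Path v (es ++ fs) x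
  []       ++ᵖ q = q
  (eq ∷ p) ++ᵖ q = eq ∷ (p ++ᵖ q)

  Path-split : Path v es w → x ∈ v ∷ map tgt es →
    ∃[ ps ] ∃[ qs ] es ≡ ps ++ qs × Path v ps x × Path x qs w
  Path-split p        (here refl) = [] , _ , refl , [] , p
  Path-split (eq ∷ p) (there x∈) with Path-split p x∈
  ... | ps , qs , refl , p₁ , p₂ = _ ∷ ps , qs , refl , eq ∷ p₁ , p₂

  breaksAfter-path : ∀ fs → Path v es w → breaksAfter v (es ++ fs) ≡ breaksAfter w fs
  breaksAfter-path         fs []         = refl
  breaksAfter-path {v = v} fs (_∷_ {e = e} eq p) with v ≟ src e
  ... | yes _ = breaksAfter-path fs p
  ... | no  ≢ = contradiction (sym eq) ≢

  breaksAfter-≤ : ∀ v e es → breaksAfter v (e ∷ es) ≤ suc (breaksAfter (tgt e) es)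
  breaksAfter-≤ v e es with v ≟ src e
  ... | yes _ = n≤1+n _
  ... | no  _ = ≤-refl

  record Trail : Set where
    constructor trail
    field
      {source target} : V
      {edges}     : List E
      path        : Path source edges target

    vertices : List V
    vertices = source ∷ map tgt edges

  open Trail

  Closed : Trail → Set
  Closed t = source t ≡ target t

  closed? : ∀ t → Dec (Closed t)
  closed? t = source t ≟ target t

  flatten : List Trail → List E
  flatten = concatMap edges

  flatten-++ : ∀ ts us → flatten (ts ++ us) ≡ flatten ts ++ flatten us
  flatten-++ = concatMap-++ edges

  breaksAfter-flatten : ∀ v ts → breaksAfter v (flatten ts) ≤ length ts
  breaksAfter-flatten v []                     = z≤n
  breaksAfter-flatten v (trail [] ∷ ts)        = ≤-trans (breaksAfter-flatten v ts) (n≤1+n _)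
  breaksAfter-flatten v (trail (_∷_ {es = es} {w = w} {e = e} _ p) ∷ ts) = begin
    breaksAfter v (e ∷ es ++ flatten ts)            ≤⟨ breaksAfter-≤ v e _ ⟩
    suc (breaksAfter (tgt e) (es ++ flatten ts))    ≡⟨ cong suc (breaksAfter-path (flatten ts) p) ⟩
    suc (breaksAfter w (flatten ts))                ≤⟨ s≤s (breaksAfter-flatten w ts) ⟩
    suc (length ts)                                 ∎
    where open ≤-Reasoning

  -- Not an equality: neighbouring trails may fit together, and empty ones leave no trace.
  trailCount-flatten : ∀ ts → trailCount (flatten ts) ≤ length ts
  trailCount-flatten []                     = z≤n
  trailCount-flatten (trail [] ∷ ts)        = ≤-trans (trailCount-flatten ts) (n≤1+n _)
  trailCount-flatten (trail (_∷_ {es = es} {w = w} {e = e} _ p) ∷ ts) = s≤s (begin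
    breaksAfter (tgt e) (es ++ flatten ts)    ≡⟨ breaksAfter-path (flatten ts) p ⟩
    breaksAfter w (flatten ts)                ≤⟨ breaksAfter-flatten w ts ⟩
    length ts                                 ∎)
    where open ≤-Reasoning

  -- Other decompositions share the edges of a trail but not the trail; an edge at its source is
  -- what can be looked up in them.
  Nonempty : Trail → Set
  Nonempty t = ∃[ e ] e ∈ edges t × src e ≡ source t

  decompose : ∀ es → ∃[ ts ] flatten ts ≡ es × length ts ≡ trailCount es × All Nonempty ts
  decompose []       = [] , refl , refl , []
  decompose (e ∷ es) with go (tgt e) es
    where
    -- `t` continues the trail that has arrived at `v`; it alone may be empty.
    go : ∀ v es → ∃[ t ] ∃[ ts ] source t ≡ v × edges t ++ flatten ts ≡ es
      × length ts ≡ breaksAfter v es × All Nonempty ts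
    go v []       = trail [] , [] , refl , refl , refl , []
    go v (e ∷ es) with v ≟ src e | go (tgt e) es
    ... | yes eq | trail p , ts , refl , flat , len , ne =
      trail (sym eq ∷ p) , ts , refl , cong (e ∷_) flat , len , ne
    ... | no  _  | trail p , ts , refl , flat , len , ne =
      trail [] , trail (refl ∷ p) ∷ ts , refl , cong (e ∷_) flat , cong suc len
      , (e , here refl , refl) ∷ ne
  ... | trail p , ts , refl , flat , len , ne =
    trail (refl ∷ p) ∷ ts , cong (e ∷_) flat , cong suc len , (e , here refl , refl) ∷ ne

  record Compatible (t u : Trail) : Set where
    constructor compatible
    field
      end≢start : target t ≢ source u
      start≢end : target u ≢ source t
      closedˡ   : Closed t → Disjoint (vertices t) (vertices u)
      closedʳ   : Closed u → Disjoint (vertices u) (vertices t)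

  Compatible-sym : Symmetric Compatible
  Compatible-sym (compatible a b c d) = compatible b a d c

  LocallyOptimal : List E → Set
  LocallyOptimal es = ∀ ps as bs cs {zs} → es ≡ ps ++ as ++ bs ++ cs ++ zs →
    trailCount es ≤ trailCount (ps ++ cs ++ bs ++ as ++ zs)

  locallyOptimal⇒compatible : ∀ ts → LocallyOptimal (flatten ts) →
    length ts ≡ trailCount (flatten ts) → AllPairs Compatible ts
  locallyOptimal⇒compatible ts optimal minimal = allPairs-splits ts λ ts₁ {t} ts₂ {u} {ts₃} eq →
    let open Pair ts₁ t ts₂ u ts₃ eq in compatible end≢start start≢end closedˡ closedʳ
    where
    irreducible : ∀ ps as bs cs zs us → flatten ts ≡ ps ++ as ++ bs ++ cs ++ zs →
      flatten us ≡ ps ++ cs ++ bs ++ as ++ zs → ¬ length us < length ts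
    irreducible ps as bs cs zs us before after shorter = <⇒≱ shorter (begin
      length ts                               ≡⟨ minimal ⟩
      trailCount (flatten ts)                 ≤⟨ optimal ps as bs cs before ⟩
      trailCount (ps ++ cs ++ bs ++ as ++ zs) ≡⟨ cong trailCount after ⟨
      trailCount (flatten us)                 ≤⟨ trailCount-flatten us ⟩
      length us                               ∎)
      where open ≤-Reasoning

    module Pair ts₁ t ts₂ u ts₃ (eq : ts ≡ ts₁ ++ t ∷ ts₂ ++ u ∷ ts₃) where
      F₁ F₂ F₃ : List E
      F₁ = flatten ts₁
      F₂ = flatten ts₂
      F₃ = flatten ts₃

      flat : flatten ts ≡ F₁ ++ edges t ++ F₂ ++ edges u ++ F₃
      flat = ≡-trans (cong flatten eq) (≡-trans (flatten-++ ts₁ _)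
        (cong (λ fs → F₁ ++ edges t ++ fs) (flatten-++ ts₂ _)))

      count : length ts ≡ length ts₁ + suc (length ts₂ + suc (length ts₃))
      count = ≡-trans (cong length eq) (≡-trans (length-++ ts₁)
        (cong (λ n → length ts₁ + suc n) (length-++ ts₂)))

      -- `x` is the merger of `t` and `u`, here in the place of `t`, in `mergedʳ` in the place of
      -- `u`.
      mergedˡ : ∀ x ps as bs cs zs →
        F₁ ++ edges t ++ F₂ ++ edges u ++ F₃ ≡ ps ++ as ++ bs ++ cs ++ zs →
        F₁ ++ edges x ++ F₂ ++ F₃ ≢ ps ++ cs ++ bs ++ as ++ zs
      mergedˡ x ps as bs cs zs before after =
        irreducible ps as bs cs zs (ts₁ ++ x ∷ ts₂ ++ ts₃) (≡-trans flat before)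
          (≡-trans (flatten-++ ts₁ _)
            (≡-trans (cong (λ fs → F₁ ++ edges x ++ fs) (flatten-++ ts₂ ts₃)) after))
          (begin-strict
            length (ts₁ ++ x ∷ ts₂ ++ ts₃)
              ≡⟨ length-++ ts₁ ⟩
            length ts₁ + suc (length (ts₂ ++ ts₃))
              ≡⟨ cong (λ n → length ts₁ + suc n) (length-++ ts₂) ⟩
            length ts₁ + suc (length ts₂ + length ts₃)
              <⟨ +-monoʳ-< (length ts₁) (s≤s (+-monoʳ-< (length ts₂) ≤-refl)) ⟩
            length ts₁ + suc (length ts₂ + suc (length ts₃))
              ≡⟨ count ⟨
            length ts ∎)
        where open ≤-Reasoning

      mergedʳ : ∀ x ps as bs cs zs →
        F₁ ++ edges t ++ F₂ ++ edges u ++ F₃ ≡ ps ++ as ++ bs ++ cs ++ zs →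
        F₁ ++ F₂ ++ edges x ++ F₃ ≢ ps ++ cs ++ bs ++ as ++ zs
      mergedʳ x ps as bs cs zs before after =
        irreducible ps as bs cs zs (ts₁ ++ ts₂ ++ x ∷ ts₃) (≡-trans flat before)
          (≡-trans (flatten-++ ts₁ _)
            (≡-trans (cong (F₁ ++_) (flatten-++ ts₂ (x ∷ ts₃))) after))
          (begin-strict
            length (ts₁ ++ ts₂ ++ x ∷ ts₃)
              ≡⟨ length-++ ts₁ ⟩
            length ts₁ + length (ts₂ ++ x ∷ ts₃)
              ≡⟨ cong (length ts₁ +_) (length-++ ts₂) ⟩
            length ts₁ + (length ts₂ + suc (length ts₃))
              <⟨ +-monoʳ-< (length ts₁) ≤-refl ⟩
            length ts₁ + suc (length ts₂ + suc (length ts₃))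
              ≡⟨ count ⟨
            length ts ∎)
        where open ≤-Reasoning

      open Algebra.Solver.Monoid (++-monoid E) using (_⊜_)
        renaming (solve to solve-++; _⊕_ to _⊙_)

      end≢start : target t ≢ source u
      end≢start meet = mergedʳ (trail (subst (Path _ _) meet (path t) ++ᵖ path u))
        -- With an empty middle block, the interchange carries `t` past `F₂` to the start of `u`.
        F₁ (edges t) [] F₂ (edges u ++ F₃)
        refl (cong (λ fs → F₁ ++ F₂ ++ fs) (++-assoc (edges t) (edges u) F₃))

      start≢end : target u ≢ source t
      start≢end meet = mergedˡ (trail (subst (Path _ _) meet (path u) ++ᵖ path t))
        F₁ (edges t ++ F₂) [] (edges u) F₃
        (solve-++ 5 (λ f₁ t f₂ u f₃ → f₁ ⊙ (t ⊙ (f₂ ⊙ (u ⊙ f₃))) ⊜ f₁ ⊙ ((t ⊙ f₂) ⊙ (u ⊙ f₃)))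
          refl F₁ (edges t) F₂ (edges u) F₃)
        (solve-++ 5 (λ f₁ t f₂ u f₃ → f₁ ⊙ ((u ⊙ t) ⊙ (f₂ ⊙ f₃)) ⊜ f₁ ⊙ (u ⊙ ((t ⊙ f₂) ⊙ f₃)))
          refl F₁ (edges t) F₂ (edges u) F₃)

      -- A closed trail is rotated to a common vertex and inserted there.
      closedʳ : Closed u → Disjoint (vertices u) (vertices t)
      closedʳ closed (x∈u , x∈t) with Path-split (path t) x∈t | Path-split (path u) x∈u
      ... | p , q , t≡ , x₁ , x₂ | r , s , u≡ , y₁ , y₂ =
        mergedˡ (trail (x₁ ++ᵖ (subst (Path _ s) (sym closed) y₂ ++ᵖ (y₁ ++ᵖ x₂))))
          -- Exchanging `q ++ F₂` with `s` around `r` yields `p`, `s`, `r`, `q`: one interchange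
          -- both rotates and inserts. Closed trails are the reason for a middle block.
          (F₁ ++ p) (q ++ F₂) r s F₃
          (≡-trans (cong₂ (λ t u → F₁ ++ t ++ F₂ ++ u ++ F₃) t≡ u≡)
            (solve-++ 7 (λ f₁ p q f₂ r s f₃ →
                f₁ ⊙ ((p ⊙ q) ⊙ (f₂ ⊙ ((r ⊙ s) ⊙ f₃))) ⊜ (f₁ ⊙ p) ⊙ ((q ⊙ f₂) ⊙ (r ⊙ (s ⊙ f₃))))
              refl F₁ p q F₂ r s F₃))
          (solve-++ 7 (λ f₁ p q f₂ r s f₃ →
              f₁ ⊙ ((p ⊙ (s ⊙ (r ⊙ q))) ⊙ (f₂ ⊙ f₃)) ⊜ (f₁ ⊙ p) ⊙ (s ⊙ (r ⊙ ((q ⊙ f₂) ⊙ f₃))))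
            refl F₁ p q F₂ r s F₃)

      closedˡ : Closed t → Disjoint (vertices t) (vertices u)
      closedˡ closed (x∈t , x∈u) with Path-split (path t) x∈t | Path-split (path u) x∈u
      ... | r , s , t≡ , y₁ , y₂ | p , q , u≡ , x₁ , x₂ =
        mergedʳ (trail (x₁ ++ᵖ (subst (Path _ s) (sym closed) y₂ ++ᵖ (y₁ ++ᵖ x₂))))
          F₁ r s (F₂ ++ p) (q ++ F₃)
          (≡-trans (cong₂ (λ t u → F₁ ++ t ++ F₂ ++ u ++ F₃) t≡ u≡)
            (solve-++ 7 (λ f₁ p q f₂ r s f₃ →
                f₁ ⊙ ((r ⊙ s) ⊙ (f₂ ⊙ ((p ⊙ q) ⊙ f₃))) ⊜ f₁ ⊙ (r ⊙ (s ⊙ ((f₂ ⊙ p) ⊙ (q ⊙ f₃)))))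
              refl F₁ p q F₂ r s F₃))
          (solve-++ 7 (λ f₁ p q f₂ r s f₃ →
              f₁ ⊙ (f₂ ⊙ ((p ⊙ (s ⊙ (r ⊙ q))) ⊙ f₃)) ⊜ f₁ ⊙ ((f₂ ⊙ p) ⊙ (s ⊙ (r ⊙ (q ⊙ f₃)))))
            refl F₁ p q F₂ r s F₃)

  -- The lower bound by colours and weights

  module Counting (ts : List Trail) (compat : AllPairs Compatible ts) where
    Open : Trail → Set
    Open t = ¬ Closed t

    separated : ∀ {t u} → t ∈ ts → u ∈ ts → t ≡ u ⊎ Compatible t u
    separated = allPairs-lookup Compatible-sym compat

    visits? : ∀ v → Dec (Any (λ t → Closed t × v ∈ vertices t) ts)
    visits? v = any? (λ t → closed? t ×-dec v ∈? vertices t) ts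

    leaves? : ∀ v → Dec (Any (λ t → Open t × source t ≡ v) ts)
    leaves? v = any? (λ t → ¬? (closed? t) ×-dec (source t ≟ v)) ts

    -- A closed trail is a whole component, and its source names it. By compatibility, the name does
    -- not depend on which trail `visits?` happens to find.
    colour : V → Maybe V
    colour v with visits? v
    ... | yes p = just (source (proj₁ (find p)))
    ... | no  _ = nothing

    -- Summed over sources and over targets of edges, this indicator extracts the surplus of
    -- out-degree over in-degree at the vertices where open trails start.
    weight : V → ℕ
    weight v with leaves? v
    ... | yes _ = 1
    ... | no  _ = 0

    colour-closed : ∀ {t v} → t ∈ ts → Closed t → v ∈ vertices t → colour v ≡ just (source t)
    colour-closed {v = v} t∈ closed v∈ with visits? v
    ... | no none = contradiction (lose t∈ (closed , v∈)) none
    ... | yes p with find p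
    ...   | u , u∈ , _ , v∈u with separated t∈ u∈
    ...     | inj₁ refl = refl
    ...     | inj₂ c    = contradiction (v∈ , v∈u) (Compatible.closedˡ c closed)

    colour-open : ∀ {t v} → t ∈ ts → Open t → v ∈ vertices t → colour v ≡ nothing
    colour-open {v = v} t∈ isOpen v∈ with visits? v
    ... | no _ = refl
    ... | yes p with find p
    ...   | u , u∈ , closed , v∈u with separated t∈ u∈
    ...     | inj₁ refl = contradiction closed isOpen
    ...     | inj₂ c    = contradiction (v∈u , v∈) (Compatible.closedʳ c closed)

    -- Both ends lie on the trail through `e`, and a trail has a single colour: its source if it is
    -- closed, none if it is open.
    colour-edge : ∀ {e} → e ∈ flatten ts → colour (src e) ≡ colour (tgt e)
    colour-edge e∈ with find (∈-concatMap⁻ edges e∈)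
    ... | t , t∈ , e∈t with closed? t | ends (path t) e∈t
      where
      ends : ∀ {v es w e} → Path v es w → e ∈ es → src e ∈ v ∷ map tgt es × tgt e ∈ v ∷ map tgt es
      ends (eq ∷ p) (here refl) = here eq , there (here refl)
      ends (_ ∷ p)  (there e∈)  = let s∈ , t∈ = ends p e∈ in there s∈ , there t∈
    ...   | yes closed | s∈ , t′∈ =
      ≡-trans (colour-closed t∈ closed s∈) (sym (colour-closed t∈ closed t′∈))
    ...   | no  isOpen | s∈ , t′∈ =
      ≡-trans (colour-open t∈ isOpen s∈) (sym (colour-open t∈ isOpen t′∈))

    weight≤1 : ∀ v → weight v ≤ 1
    weight≤1 v with leaves? v
    ... | yes _ = ≤-refl
    ... | no  _ = z≤n

    weight-coloured : ∀ {v w} → colour v ≡ just w → weight v ≡ 0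
    weight-coloured {v} coloured with leaves? v
    ... | no _  = refl
    ... | yes p with find p
    ...   | u , u∈ , isOpen , refl with ≡-trans (sym coloured) (colour-open u∈ isOpen (here refl))
    ...     | ()

    weight-start : ∀ {t} → t ∈ ts → Open t → weight (source t) ≡ 1
    weight-start {t} t∈ isOpen with leaves? (source t)
    ... | yes _   = refl
    ... | no none = contradiction (lose t∈ (isOpen , refl)) none

    weight-end : ∀ {t} → t ∈ ts → Open t → weight (target t) ≡ 0
    weight-end {t} t∈ isOpen with leaves? (target t)
    ... | no _  = refl
    ... | yes p with find p
    ...   | u , u∈ , _ , eq with separated t∈ u∈
    ...     | inj₁ refl = contradiction eq isOpen
    ...     | inj₂ c    = contradiction (sym eq) (Compatible.end≢start c)

    out into : List E → ℕ
    out es  = sum (map (weight ∘ src) es)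
    into es = sum (map (weight ∘ tgt) es)

    telescope : ∀ {v es w} → Path v es w → weight v + into es ≡ out es + weight w
    telescope {v}             []         = +-identityʳ (weight v)
    telescope {es = e ∷ es} (refl ∷ p) =
      ≡-trans (cong (weight (src e) +_) (telescope p)) (sym (+-assoc (weight (src e)) (out es) _))

    sum-flatten : ∀ (f : E → ℕ) t us →
      sum (map f (flatten (t ∷ us))) ≡ sum (map f (edges t)) + sum (map f (flatten us))
    sum-flatten f t us =
      ≡-trans (cong sum (map-++ f (edges t) (flatten us))) (sum-++ (map f (edges t)) _)

    closedStarts : List Trail → List V
    closedStarts us = map source (filter closed? us)

    -- An open trail goes from weight 1 to weight 0 and so adds 1 to the excess of `out` over
    -- `into`; a closed one adds nothing and is counted by `closedStarts`.
    into-bound : ∀ {us} → All (_∈ ts) us →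
      into (flatten us) + length us ≤ out (flatten us) + length (closedStarts us)
    into-bound {[]}     []          = z≤n
    into-bound {u ∷ us} (u∈ ∷ us∈)
      rewrite sum-flatten (weight ∘ tgt) u us | sum-flatten (weight ∘ src) u us
      with closed? u
    ... | yes closed = +-mono₂-≤ {into (edges u)} {out (edges u)} {1} {1}
      (+-monoˡ-≤ 1 (≤-reflexive balanced)) (into-bound us∈)
      where
      balanced : into (edges u) ≡ out (edges u)
      balanced = +-cancelˡ-≡ (weight (source u)) _ _ (≡-trans (telescope (path u))
        (≡-trans (cong (λ v → out (edges u) + weight v) (sym closed)) (+-comm (out (edges u)) _)))
    ... | no  isOpen = +-mono₂-≤ {into (edges u)} {out (edges u)} {1} {0}
      (≤-reflexive unbalanced) (into-bound us∈)
      where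
      unbalanced : into (edges u) + 1 ≡ out (edges u) + 0
      unbalanced = begin
        into (edges u) + 1                  ≡⟨ +-comm _ 1 ⟩
        1 + into (edges u)                  ≡⟨ cong (_+ into (edges u)) (weight-start u∈ isOpen) ⟨
        weight (source u) + into (edges u)   ≡⟨ telescope (path u) ⟩
        out (edges u) + weight (target u)      ≡⟨ cong (out (edges u) +_) (weight-end u∈ isOpen) ⟩
        out (edges u) + 0                   ∎
        where open ≡-Reasoning

    startColours : List Trail → List V
    startColours = mapMaybe (colour ∘ source)

    -- Here the trails are arbitrary. One trail adds at most the weight of its source to the excess
    -- of `out` over `into`: at most 1, and 0 if the source is coloured, because no open trail of
    -- `ts` starts in a closed component.
    out-bound : ∀ us → out (flatten us) + length (startColours us) ≤ into (flatten us) + length us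
    out-bound []       = z≤n
    out-bound (u ∷ us)
      rewrite sum-flatten (weight ∘ src) u us | sum-flatten (weight ∘ tgt) u us
      with colour (source u) in coloured
    ... | just _  = +-mono₂-≤ {out (edges u)} {into (edges u)} {1} {1} (+-monoˡ-≤ 1 (begin
      out (edges u)                      ≤⟨ m≤m+n _ _ ⟩
      out (edges u) + weight (target u)     ≡⟨ telescope (path u) ⟨
      weight (source u) + into (edges u)  ≡⟨ cong (_+ into (edges u)) (weight-coloured coloured) ⟩
      into (edges u)                     ∎)) (out-bound us)
      where open ≤-Reasoning
    ... | nothing = +-mono₂-≤ {out (edges u)} {into (edges u)} {0} {1} (begin
      out (edges u) + 0                  ≤⟨ +-monoʳ-≤ (out (edges u)) z≤n ⟩
      out (edges u) + weight (target u)     ≡⟨ telescope (path u) ⟨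
      weight (source u) + into (edges u)  ≤⟨ +-monoˡ-≤ _ (weight≤1 (source u)) ⟩
      1 + into (edges u)                 ≡⟨ +-comm 1 _ ⟩
      into (edges u) + 1                 ∎) (out-bound us)
      where open ≤-Reasoning

    colour-path : ∀ {v es w e} → Path v es w → es ⊆ flatten ts → e ∈ es → colour v ≡ colour (src e)
    colour-path (refl ∷ p) es⊆ (here refl) = refl
    colour-path (refl ∷ p) es⊆ (there e∈)  =
      ≡-trans (colour-edge (es⊆ (here refl))) (colour-path p (es⊆ ∘ there) e∈)

    -- The first edge of a closed trail lies on some trail of `us`, and since colours are constant
    -- along paths, that trail starts in the same colour.
    closedStarts⊆startColours : ∀ {us} → All Nonempty ts → flatten us ↭ flatten ts →
      closedStarts ts ⊆ startColours us
    closedStarts⊆startColours {us} nonempty us↭ts v∈ with ∈-map⁻ source v∈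
    ... | t , t∈filter , refl with ∈-filter⁻ closed? t∈filter
    ...   | t∈ , closed with All.lookup nonempty t∈
    ...     | e , e∈t , start≡
      with find (∈-concatMap⁻ edges {xs = us}
             (∈-resp-↭ (↭-sym us↭ts) (∈-concatMap⁺ edges (lose t∈ e∈t))))
    ...       | u , u∈ , e∈u = ∈-mapMaybe⁺ (colour ∘ source) u∈ (begin
      colour (source u)  ≡⟨ colour-path (path u) u⊆ e∈u ⟩
      colour (src e)    ≡⟨ cong colour start≡ ⟩
      colour (source t)  ≡⟨ colour-closed t∈ closed (here refl) ⟩
      just (source t)    ∎)
      where
      open ≡-Reasoning
      u⊆ : edges u ⊆ flatten ts
      u⊆ e∈ = ∈-resp-↭ us↭ts (∈-concatMap⁺ edges (lose u∈ e∈))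

  unique-closedStarts : ∀ {ts} (compat : AllPairs Compatible ts) →
    Unique (map source (filter closed? ts))
  unique-closedStarts []       = []
  unique-closedStarts {t ∷ ts} (c ∷ cs) with closed? t
  ... | no  _      = unique-closedStarts cs
  ... | yes closed =
    All.map⁺ (All.filter⁺ closed? (All.map (λ c eq → Compatible.closedˡ c closed (here refl , here eq)) c))
    ∷ unique-closedStarts cs

  -- `out` and `into` agree on `es` and `fs`, so `into-bound` for the one and `out-bound` for the
  -- other speak of the same numbers. Distinct closed trails have distinct starts, which bounds
  -- their number by that of the coloured starts in `us`.
  locallyOptimal⇒optimal : LocallyOptimal es → fs ↭ es → trailCount es ≤ trailCount fs
  locallyOptimal⇒optimal {es} {fs} optimal fs↭es with decompose es | decompose fs
  ... | ts , refl , |ts| , nonempty | us , refl , |us| , _ =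
    +-cancelˡ-≤ (into (flatten ts)) _ _ (begin
      into (flatten ts) + trailCount (flatten ts)
        ≡⟨ cong (into (flatten ts) +_) |ts| ⟨
      into (flatten ts) + length ts
        ≤⟨ into-bound (All.tabulate (λ t∈ → t∈)) ⟩
      out (flatten ts) + length (closedStarts ts)
        ≤⟨ +-monoʳ-≤ (out (flatten ts))
             (pigeonhole (unique-closedStarts compat) (closedStarts⊆startColours {us} nonempty fs↭es)) ⟩
      out (flatten ts) + length (startColours us)
        ≡⟨ cong (_+ length (startColours us)) (sum-↭ (map⁺ (weight ∘ src) fs↭es)) ⟨
      out (flatten us) + length (startColours us)
        ≤⟨ out-bound us ⟩
      into (flatten us) + length us
        ≡⟨ cong₂ _+_ (sum-↭ (map⁺ (weight ∘ tgt) fs↭es)) |us| ⟩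
      into (flatten ts) + trailCount (flatten us) ∎)
    where
    open ≤-Reasoning
    compat : AllPairs Compatible ts
    compat = locallyOptimal⇒compatible ts optimal |ts|
    open Counting ts compat

-- Strings as edges

-- Lifts blocks of edges to blocks of strings; the empty strings, which are not edges, fall into one
-- block or another.
mapMaybe-split : ∀ {A B : Set} (f : A → Maybe B) xs {ys zs} → mapMaybe f xs ≡ ys ++ zs →
  ∃[ xs₁ ] ∃[ xs₂ ] xs ≡ xs₁ ++ xs₂ × mapMaybe f xs₁ ≡ ys × mapMaybe f xs₂ ≡ zs
mapMaybe-split f xs       {[]}     eq = [] , xs , refl , refl , eq
mapMaybe-split f (x ∷ xs) {y ∷ ys} eq with f x in fx
... | nothing with mapMaybe-split f xs {y ∷ ys} eq
...   | xs₁ , xs₂ , refl , eq₁ , eq₂ = x ∷ xs₁ , xs₂ , refl , skip , eq₂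
  where
  skip : mapMaybe f (x ∷ xs₁) ≡ y ∷ ys
  skip rewrite fx = eq₁
mapMaybe-split f (x ∷ xs) {y ∷ ys} eq | just _ with ∷-injective eq
... | refl , eq′ with mapMaybe-split f xs {ys} eq′
...   | xs₁ , xs₂ , refl , eq₁ , eq₂ = x ∷ xs₁ , xs₂ , refl , keep , eq₂
  where
  keep : mapMaybe f (x ∷ xs₁) ≡ y ∷ ys
  keep rewrite fx = cong (y ∷_) eq₁

interchange-↭ : ∀ {A : Set} (ps as bs cs : List A) {zs} →
  ps ++ cs ++ bs ++ as ++ zs ↭ ps ++ as ++ bs ++ cs ++ zs
interchange-↭ ps as bs cs = ++⁺ˡ ps
  (↭-trans (shifts cs bs) (↭-trans (++⁺ˡ bs (shifts cs as)) (shifts bs as)))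

module Optimality (𝔸 : Alphabet) where
  open Alphabet 𝔸

  finalChar : Char → String → Char
  finalChar c []      = c
  finalChar c (d ∷ s) = finalChar d s

  -- A nonempty string is an edge from its first to its last character.
  Edge : Set
  Edge = Char × String

  first last : Edge → Char
  first = proj₁
  last (c , s) = finalChar c s

  open Multigraph _≟_ first last using (breaksAfter; trailCount; locallyOptimal⇒optimal)
    renaming (LocallyOptimal to LocallyOptimalTrail)

  toEdge : String → Maybe Edge
  toEdge []      = nothing
  toEdge (c ∷ s) = just (c , s)

  toEdges : List String → List Edge
  toEdges = mapMaybe toEdge

  changes : Char → String → ℕ
  changes c []      = 0
  changes c (d ∷ s) with c ≟ d
  ... | yes _ = changes d s
  ... | no  _ = suc (changes d s)

  phraseCount : String → ℕ
  phraseCount s = length (runLengthEncoding s)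

  phraseCount-changes : ∀ c s → phraseCount (c ∷ s) ≡ suc (changes c s)
  phraseCount-changes c s = proj₂ (proj₂ (go c s))
    where
    -- The induction has to know the character of the first phrase, with which `prepend` compares.
    go : ∀ c s → ∃[ n ] (∃[ ps ] runLengthEncoding (c ∷ s) ≡ (c , n) ∷ ps)
      × phraseCount (c ∷ s) ≡ suc (changes c s)
    go c []      = 1 , ([] , refl) , refl
    go c (d ∷ s) with runLengthEncoding (d ∷ s) | go d s
    ... | _ | n , (ps , refl) , eq with c ≟ d
    ...   | yes refl = suc n , (ps , refl) , eq
    ...   | no  _    = 1 , (_ , refl) , cong suc eq

  changes-++ : ∀ c s t → changes c (s ++ t) ≡ changes c s + changes (finalChar c s) t
  changes-++ c []      t = refl
  changes-++ c (d ∷ s) t with c ≟ d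
  ... | yes _ = changes-++ d s t
  ... | no  _ = cong suc (changes-++ d s t)

  changes-≤ : ∀ c s → changes c s ≤ phraseCount s
  changes-≤ c []      = z≤n
  changes-≤ c (d ∷ s) rewrite phraseCount-changes d s with c ≟ d
  ... | yes _ = n≤1+n _
  ... | no  _ = ≤-refl

  -- Joining may merge two phrases at the seam and never splits one.
  phraseCount-++ : ∀ s t → phraseCount (s ++ t) ≤ phraseCount s + phraseCount t
  phraseCount-++ []      t = ≤-refl
  phraseCount-++ (c ∷ s) t
    rewrite phraseCount-changes c (s ++ t) | phraseCount-changes c s | changes-++ c s t =
    s≤s (+-monoʳ-≤ (changes c s) (changes-≤ (finalChar c s) t))

  phrases-concat : ∀ S → phrases (concat S) ≤ totalPhrases S
  phrases-concat []      = z≤n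
  phrases-concat (B ∷ S) = begin
    phraseCount (concat (B ++ concat S))             ≡⟨ cong phraseCount (concat-++ B (concat S)) ⟨
    phraseCount (concat B ++ concat (concat S))      ≤⟨ phraseCount-++ (concat B) _ ⟩
    phrases B + phrases (concat S)                   ≤⟨ +-monoʳ-≤ (phrases B) (phrases-concat S) ⟩
    phrases B + totalPhrases S                       ∎
    where open ≤-Reasoning

  inner : List Edge → ℕ
  inner es = sum (map (λ (c , s) → changes c s) es)

  changes-append : ∀ c s xs → changes c (s ++ concat xs)
    ≡ inner (toEdges ((c ∷ s) ∷ xs)) + breaksAfter (finalChar c s) (toEdges xs)

  changes-toEdges : ∀ c xs → changes c (concat xs) ≡ inner (toEdges xs) + breaksAfter c (toEdges xs)
  changes-toEdges c []             = refl
  changes-toEdges c ([] ∷ xs)      = changes-toEdges c xs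
  changes-toEdges c ((d ∷ s) ∷ xs) with c ≟ d
  ... | yes _ = changes-append d s xs
  ... | no  _ = ≡-trans (cong suc (changes-append d s xs)) (sym (+-suc (inner (toEdges ((d ∷ s) ∷ xs))) _))

  changes-append c s xs = begin
    changes c (s ++ concat xs)
      ≡⟨ changes-++ c s (concat xs) ⟩
    changes c s + changes (finalChar c s) (concat xs)
      ≡⟨ cong (changes c s +_) (changes-toEdges (finalChar c s) xs) ⟩
    changes c s + (inner (toEdges xs) + breaksAfter (finalChar c s) (toEdges xs))
      ≡⟨ +-assoc (changes c s) _ _ ⟨
    inner (toEdges ((c ∷ s) ∷ xs)) + breaksAfter (finalChar c s) (toEdges xs) ∎
    where open ≡-Reasoning

  -- Apart from the first, every phrase begins inside a string or at a break between consecutive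
  -- nonempty strings. The former are independent of the order, so minimizing phrases is minimizing
  -- trails.
  phrases-toEdges : ∀ xs → phrases xs ≡ inner (toEdges xs) + trailCount (toEdges xs)
  phrases-toEdges []             = refl
  phrases-toEdges ([] ∷ xs)      = phrases-toEdges xs
  phrases-toEdges ((c ∷ s) ∷ xs) = begin
    phraseCount (c ∷ s ++ concat xs)
      ≡⟨ phraseCount-changes c (s ++ concat xs) ⟩
    suc (changes c (s ++ concat xs))
      ≡⟨ cong suc (changes-append c s xs) ⟩
    suc (inner (toEdges ((c ∷ s) ∷ xs)) + breaksAfter (finalChar c s) (toEdges xs))
      ≡⟨ +-suc (inner (toEdges ((c ∷ s) ∷ xs))) _ ⟨
    inner (toEdges ((c ∷ s) ∷ xs)) + trailCount (toEdges ((c ∷ s) ∷ xs)) ∎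
    where open ≡-Reasoning

  inner-↭ : ∀ {es fs} → es ↭ fs → inner es ≡ inner fs
  inner-↭ es↭fs = sum-↭ (map⁺ _ es↭fs)

  open Descent 𝔸

  toEdges-++⁵ : ∀ ps as bs cs zs → toEdges (ps ++ as ++ bs ++ cs ++ zs)
    ≡ toEdges ps ++ toEdges as ++ toEdges bs ++ toEdges cs ++ toEdges zs
  toEdges-++⁵ ps as bs cs zs
    rewrite mapMaybe-++ toEdge ps (as ++ bs ++ cs ++ zs) | mapMaybe-++ toEdge as (bs ++ cs ++ zs)
          | mapMaybe-++ toEdge bs (cs ++ zs) | mapMaybe-++ toEdge cs zs = refl

  toEdges-locallyOptimal : ∀ {xs} → LocallyOptimal xs → LocallyOptimalTrail (toEdges xs)
  toEdges-locallyOptimal {xs} optimal ps′ as′ bs′ cs′ eq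
    with ps , xs₁ , refl , refl , eq₁ ← mapMaybe-split toEdge xs {ps′} eq
    with as , xs₂ , refl , refl , eq₂ ← mapMaybe-split toEdge xs₁ {as′} eq₁
    with bs , xs₃ , refl , refl , eq₃ ← mapMaybe-split toEdge xs₂ {bs′} eq₂
    with cs , zs , refl , refl , refl ← mapMaybe-split toEdge xs₃ {cs′} eq₃
    = +-cancelˡ-≤ (inner before) _ _ (begin
      inner before + trailCount before
        ≡⟨ phrases-toEdges (ps ++ as ++ bs ++ cs ++ zs) ⟨
      phrases (ps ++ as ++ bs ++ cs ++ zs)
        ≤⟨ optimal ps as bs cs refl ⟩
      phrases (ps ++ cs ++ bs ++ as ++ zs)
        ≡⟨ phrases-toEdges (ps ++ cs ++ bs ++ as ++ zs) ⟩
      inner after + trailCount after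
        ≡⟨ cong₂ _+_ (inner-↭ (mapMaybe-↭ toEdge (interchange-↭ ps as bs cs)))
             (cong trailCount (toEdges-++⁵ ps cs bs as zs)) ⟩
      inner before + trailCount (toEdges ps ++ toEdges cs ++ toEdges bs ++ toEdges as ++ toEdges zs) ∎)
    where
    open ≤-Reasoning
    before = toEdges (ps ++ as ++ bs ++ cs ++ zs)
    after  = toEdges (ps ++ cs ++ bs ++ as ++ zs)

  locallyOptimal-minimal : ∀ {xs ys} → LocallyOptimal xs → ys ↭ xs → phrases xs ≤ phrases ys
  locallyOptimal-minimal {xs} {ys} optimal ys↭xs = begin
    phrases xs
      ≡⟨ phrases-toEdges xs ⟩
    inner (toEdges xs) + trailCount (toEdges xs)
      ≤⟨ +-monoʳ-≤ (inner (toEdges xs))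
           (locallyOptimal⇒optimal (toEdges-locallyOptimal optimal) (mapMaybe-↭ toEdge ys↭xs)) ⟩
    inner (toEdges xs) + trailCount (toEdges ys)
      ≡⟨ cong (_+ trailCount (toEdges ys)) (inner-↭ (mapMaybe-↭ toEdge ys↭xs)) ⟨
    inner (toEdges ys) + trailCount (toEdges ys)
      ≡⟨ phrases-toEdges ys ⟨
    phrases ys ∎
    where open ≤-Reasoning

  -- Distinctness within batches and disjointness between them leave no repetition in `concat S`,
  -- and lists without repetition that have the same elements are permutations of each other.
  schedule-↭ : ∀ {X S} → Unique X → IsSchedule X S → concat S ↭ X
  schedule-↭ {X} {S} unique isSchedule = ∼bag⇒↭ (unique∧set⇒bag
    (Unique.concat⁺ (All.map IsBatch.distinct batches) disjoint) unique
    (mk⇔ (λ x∈ → let _ , x∈B , B∈S = ∈-concat⁻′ S x∈ in IsBatch.subset (All.lookup batches B∈S) x∈B)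
         (λ x∈ → ∈-concat⁺ (covering x∈))))
    where open IsSchedule isSchedule

  open Search 𝔸

  schedule-isSchedule : ∀ {X} → Unique X → IsSchedule X (schedule X)
  schedule-isSchedule {[]}    _      = record
    { batches = [] ; nonempty = [] ; disjoint = [] ; covering = λ () }
  schedule-isSchedule {x ∷ X} unique = record
    { batches  = record
        { distinct = PermutationSetoid.Unique-resp-↭ (setoid String) (↭⇒↭ₛ (↭-sym permutation)) unique
        ; subset   = ∈-resp-↭ permutation
        } ∷ []
    ; nonempty = (λ empty → ¬x∷xs↭[] (↭-trans (↭-sym permutation) (↭-reflexive empty))) ∷ []
    ; disjoint = [] ∷ []
    ; covering = λ x∈ → here (∈-resp-↭ (↭-sym permutation) x∈)
    }
    where permutation = descend-↭ (x ∷ X)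

  totalPhrases-schedule : ∀ X → totalPhrases (schedule X) ≤ phrases (descend X)
  totalPhrases-schedule []      = z≤n
  totalPhrases-schedule (x ∷ X) = ≤-reflexive (+-identityʳ _)

  schedule-optimal : ∀ {X S} → Unique X → IsSchedule X S → totalPhrases (schedule X) ≤ totalPhrases S
  schedule-optimal {X} {S} unique isSchedule = begin
    totalPhrases (schedule X)  ≤⟨ totalPhrases-schedule X ⟩
    phrases (descend X)        ≤⟨ locallyOptimal-minimal (descend-optimal X)
                                    (↭-trans (schedule-↭ unique isSchedule) (↭-sym (descend-↭ X))) ⟩
    phrases (concat S)         ≤⟨ phrases-concat S ⟩
    totalPhrases S             ∎
    where open ≤-Reasoning

theorem2 : SolvableInPolynomialTime minimumRLESchedule
theorem2 = toProgram solver , const 7 ⊕ time solver , λ I → let open StringSet I in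
    Search.schedule alphabet strings
  , ( Optimality.schedule-isSchedule alphabet unique
    , λ S → Optimality.schedule-optimal alphabet unique )
  , toProgram-computes solver I
  where
  solver : MinimizationProblem.encodeInstance minimumRLESchedule ⟶
    (λ I → MinimizationProblem.encodeSolution minimumRLESchedule I
             (Search.schedule (StringSet.alphabet I) (StringSet.strings I)))
  solver = schedule⟶ StringSet.alphabet input
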